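{- Let $F=K_{2k}$ with $k\ge 1$, and let $E_k\subseteq E(F)$ be a set of $k$ edges such that the subgraph $\mathscr E_k$ induced by $E_k$ is a perfect matching of $F$. Let $H_{uv}$ be a simple graph of order $m\ge3$ with a specified edge $uv$ such that $u$ and $v$ both have degree $m-1$ in $H_{uv}$, and suppose $H_2=H_{uv}-\{u,v\}$ is $r_2$-regular with $r_2\ge2$. Let $G=G[F,E_k,H_{uv}]$, and let $\zeta,\eta$ be the two roots of $(x-2r_2-2)(x-m)-2(m-2)=0$. Then the spectrum of the signless Laplacian matrix $Q(G)$ is given by: (i) $q$ with multiplicity $k$, for each $q\in\sigma(Q(H_{uv}))\setminus\{m-2,\zeta,\eta\}$; (ii) $m+2k-4$ with multiplicity $k$; (iii) the two roots of the equation $(x-m-4k+4)(x-2r_2-2)-2(m-2)=0$, each with multiplicity $1$; (iv) the two roots of the equation $(x-m-2k+4)(x-2r_2-2)-2(m-2)=0$, each with multiplicity $k-1$.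
   Context: All graphs are finite and simple. $Q(X)=D(X)+A(X)$ is the signless Laplacian matrix of a graph $X$ ($D$ the diagonal degree matrix, $A$ the adjacency matrix), and $\sigma(\cdot)$ is the spectrum as a multiset with multiplicity; differences are multiset differences, and the spectrum described by the list is the multiset union of the listed items. For a graph $X$ of order $s$, $q_1(X)\le\cdots\le q_s(X)$ are the eigenvalues of $Q(X)$. Under the stated hypotheses, $\sigma(Q(H_{uv}))=\{q_j(H_2)+2:1\le j\le m-3\}\cup\{m-2,\zeta,\eta\}$ as multisets. $K_{2k}$ is the complete graph on $2k$ vertices. Graph with $k$ edge-pockets: $H_{uv}$ is a graph with a specified edge $uv$ such that $H_{uv}-u\cong H_{uv}-v$ (automatic when $u,v$ both have degree $m-1$). For $E_k=\{e_1,\ldots,e_k\}\subseteq E(F)$, $G[F,E_k,H_{uv}]$ is obtained by taking one copy of $F$ and $k$ vertex-disjoint copies of $H_{uv}$, and, for each $i=1,\ldots,k$, pasting (identifying) the edge $uv$ of the $i$th copy of $H_{uv}$ with the edge $e_i$ of $F$. -}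

module Defs where

open import Algebra.Bundles using (CommutativeRing; Semiring)
import Algebra.Definitions.RawMonoid as RawMonoidDefs
import Algebra.Definitions.RawSemiring as RawSemiringDefs
open import Data.Bool.Base using (if_then_else_)
open import Data.Fin.Base using (Fin; zero; suc; toℕ; punchIn; punchOut; combine; _↑ˡ_; _↑ʳ_; splitAt)
open import Data.Fin.Properties
  using (_≟_; any?; punchOut-injective; combine-injectiveʳ; ↑ˡ-injective; ↑ʳ-injective;
         splitAt-↑ˡ; splitAt-↑ʳ)
open import Data.List.Base using (List; []; _∷_; foldl; foldr; length; filter; allFin)
open import Data.Nat.Base as ℕ using (ℕ; zero; suc)
open import Data.Product using (_×_; _,_; ∃; ∃₂; ∃!)
open import Data.Sum.Base using (_⊎_; inj₁; inj₂)
open import Data.Vec.Functional using (Vector; removeAt)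
open import Function.Base using (_∘_)
open import Level using (_⊔_; 0ℓ) renaming (suc to lsuc)
open import Relation.Binary.Core using (Rel)
open import Relation.Binary.Definitions using (Symmetric; Irreflexive; Decidable)
open import Relation.Binary.PropositionalEquality
  using (_≡_; _≢_; refl; sym; trans; cong; ≢-sym)
open import Relation.Binary.Structures using (IsDecTotalOrder)
open import Relation.Nullary.Decidable
  using (yes; no; does; ¬?; _×-dec_; _⊎-dec_)
open import Relation.Nullary.Negation using (¬_; contradiction)

------------------------------------------------------------------------
-- Finite simple graphs

record Graph (n : ℕ) : Set₁ where
  field
    Adj    : Rel (Fin n) 0ℓ
    adj?   : Decidable Adj
    symm   : Symmetric Adj
    irrefl : Irreflexive _≡_ Adj

open Graph public

degree : ∀ {n} → Graph n → Fin n → ℕ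
degree {n} X x = length (filter (adj? X x) (allFin n))

IsRegular : ∀ {n} → ℕ → Graph n → Set
IsRegular r X = ∀ x → degree X x ≡ r

complete : ∀ n → Graph n
complete n = record
  { Adj    = _≢_
  ; adj?   = λ x y → ¬? (x ≟ y)
  ; symm   = ≢-sym
  ; irrefl = λ x≡y x≢y → x≢y x≡y
  }

-- When f is injective this is the subgraph induced by its image.
pullback : ∀ {m n} → (Fin m → Fin n) → Graph n → Graph m
pullback f X = record
  { Adj    = λ x y → Adj X (f x) (f y)
  ; adj?   = λ x y → adj? X (f x) (f y)
  ; symm   = symm X
  ; irrefl = λ x≡y → irrefl X (cong f x≡y)
  }

------------------------------------------------------------------------
-- Sets of k edges

-- An enumeration e₁,…,e_k of a set of k edges of F.  Each edge is listed
-- with an orientation, which says which end u (resp. v) is pasted to.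
record EdgeSet {n} (F : Graph n) (k : ℕ) : Set where
  field
    src tgt  : Fin k → Fin n
    edge     : ∀ i → Adj F (src i) (tgt i)
    distinct : ∀ {i j} → i ≢ j →
               ¬ ((src i ≡ src j × tgt i ≡ tgt j) ⊎ (src i ≡ tgt j × tgt i ≡ src j))

  _IsEndOf_ : Fin n → Fin k → Set
  x IsEndOf i = x ≡ src i ⊎ x ≡ tgt i

  IsPerfectMatching : Set
  IsPerfectMatching = ∀ x → ∃! _≡_ (x IsEndOf_)

------------------------------------------------------------------------
-- Edge-pockets

-- A graph H_uv of order 2 + p with a specified edge uv.  The condition
-- H_uv - u ≅ H_uv - v, whose only role is to make the result of pasting
-- independent of the orientations, is not a field: it is automatic when
-- u and v are adjacent to all other vertices.
record EdgePocket (p : ℕ) : Set₁ where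
  field
    H   : Graph (2 ℕ.+ p)
    u v : Fin (2 ℕ.+ p)
    uv  : Adj H u v

  u≢v : u ≢ v
  u≢v u≡v = irrefl H u≡v uv

  -- The order-preserving bijection from Fin p onto the vertices other
  -- than u and v ...
  inner : Fin p → Fin (2 ℕ.+ p)
  inner = punchIn u ∘ punchIn (punchOut u≢v)

  -- ... and its inverse.
  outer : ∀ {w} → u ≢ w → v ≢ w → Fin p
  outer u≢w v≢w = punchOut {i = punchOut u≢v} {j = punchOut u≢w}
    (v≢w ∘ punchOut-injective u≢v u≢w)

  H-uv : Graph p
  H-uv = pullback inner H

-- G[F,E_k,H_uv].  Its vertices are those of F followed by k copies of
-- V(H_uv) ∖ {u,v}; an edge is the image of an edge of F or of an edge of
-- one of the copies of H_uv.
module Pasting {n k p} (F : Graph n) (E : EdgeSet F k) (P : EdgePocket p) where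
  open EdgeSet E
  open EdgePocket P

  order : ℕ
  order = n ℕ.+ k ℕ.* p

  fromF : Fin n → Fin order
  fromF x = x ↑ˡ (k ℕ.* p)

  fromInner : Fin k → Fin p → Fin order
  fromInner i w = n ↑ʳ combine i w

  fromH : Fin k → Fin (2 ℕ.+ p) → Fin order
  fromH i w with u ≟ w | v ≟ w
  ... | yes _   | _       = fromF (src i)
  ... | no _    | yes _   = fromF (tgt i)
  ... | no u≢w  | no v≢w  = fromInner i (outer u≢w v≢w)

  private
    src≢tgt : ∀ i → src i ≢ tgt i
    src≢tgt i eq = irrefl F eq (edge i)

    fromF-injective : ∀ {x y} → fromF x ≡ fromF y → x ≡ y
    fromF-injective = ↑ˡ-injective (k ℕ.* p) _ _

    fromF≢fromInner : ∀ {x i w} → fromF x ≢ fromInner i w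
    fromF≢fromInner {x} {i} {w} eq
      with trans (sym (splitAt-↑ˡ n x (k ℕ.* p)))
                 (trans (cong (splitAt n) eq)
                        (splitAt-↑ʳ n (k ℕ.* p) (combine i w)))
    ... | ()

  fromH-injective : ∀ i {w x} → fromH i w ≡ fromH i x → w ≡ x
  fromH-injective i {w} {x} eq with u ≟ w | v ≟ w | u ≟ x | v ≟ x
  ... | yes u≡w | _       | yes u≡x | _       = trans (sym u≡w) u≡x
  ... | yes _   | _       | no _    | yes _   = contradiction (fromF-injective eq) (src≢tgt i)
  ... | yes _   | _       | no _    | no _    = contradiction eq fromF≢fromInner
  ... | no _    | yes _   | yes _   | _       = contradiction (sym (fromF-injective eq)) (src≢tgt i)
  ... | no _    | yes v≡w | no _    | yes v≡x = trans (sym v≡w) v≡x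
  ... | no _    | yes _   | no _    | no _    = contradiction eq fromF≢fromInner
  ... | no _    | no _    | yes _   | _       = contradiction (sym eq) fromF≢fromInner
  ... | no _    | no _    | no _    | yes _   = contradiction (sym eq) fromF≢fromInner
  ... | no u≢w  | no v≢w  | no u≢x  | no v≢x  =
    punchOut-injective u≢w u≢x
      (punchOut-injective (v≢w ∘ punchOut-injective u≢v u≢w)
                          (v≢x ∘ punchOut-injective u≢v u≢x)
        (combine-injectiveʳ i _ i _ (↑ʳ-injective n _ _ eq)))

  EdgeOfF : Rel (Fin order) 0ℓ
  EdgeOfF x y = ∃₂ λ a b → fromF a ≡ x × fromF b ≡ y × Adj F a b

  EdgeOfCopy : Fin k → Rel (Fin order) 0ℓ
  EdgeOfCopy i x y = ∃₂ λ a b → fromH i a ≡ x × fromH i b ≡ y × Adj H a b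

  G : Graph order
  G = record
    { Adj    = λ x y → EdgeOfF x y ⊎ ∃ λ i → EdgeOfCopy i x y
    ; adj?   = λ x y →
        any? (λ a → any? λ b → fromF a ≟ x ×-dec fromF b ≟ y ×-dec adj? F a b)
        ⊎-dec
        any? (λ i → any? λ a → any? λ b →
          fromH i a ≟ x ×-dec fromH i b ≟ y ×-dec adj? H a b)
    ; symm   = λ
        { (inj₁ (a , b , a↦x , b↦y , ab))     → inj₁ (b , a , b↦y , a↦x , symm F ab)
        ; (inj₂ (i , a , b , a↦x , b↦y , ab)) → inj₂ (i , b , a , b↦y , a↦x , symm H ab)
        }
    ; irrefl = λ
        { x≡y (inj₁ (a , b , a↦x , b↦y , ab)) →
            irrefl F (fromF-injective (trans a↦x (trans x≡y (sym b↦y)))) ab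
        ; x≡y (inj₂ (i , a , b , a↦x , b↦y , ab)) →
            irrefl H (fromH-injective i (trans a↦x (trans x≡y (sym b↦y)))) ab
        }
    }

_[_,_] : ∀ {n k p} (F : Graph n) (E : EdgeSet F k) (P : EdgePocket p) →
         Graph (Pasting.order F E P)
F [ E , P ] = Pasting.G F E P

------------------------------------------------------------------------
-- The field in which eigenvalues are taken

-- Real closed ordered fields with decidable order.  Classically ℝ is an
-- instance.  As over ℝ, every symmetric matrix over such a field has all
-- its eigenvalues in the field.
record RealClosedField c ℓ₁ ℓ₂ : Set (lsuc (c ⊔ ℓ₁ ⊔ ℓ₂)) where
  field
    commutativeRing : CommutativeRing c ℓ₁

  open CommutativeRing commutativeRing public
    hiding (zero; refl; sym; trans)
  open RawSemiringDefs (Semiring.rawSemiring semiring) public using (_^_)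
  open RawMonoidDefs (Semiring.+-rawMonoid semiring) public using (sum) renaming (_×_ to _·_)

  infix 4 _≤_
  field
    _≤_             : Rel Carrier ℓ₂
    isDecTotalOrder : IsDecTotalOrder _≈_ _≤_
    +-mono-≤        : ∀ {x y} z → x ≤ y → x + z ≤ y + z
    *-nonNeg        : ∀ {x y} → 0# ≤ x → 0# ≤ y → 0# ≤ x * y
    0≉1             : ¬ (0# ≈ 1#)
    inverse         : ∀ {x} → ¬ (x ≈ 0#) → ∃ λ y → x * y ≈ 1#
    squareRoot      : ∀ {x} → 0# ≤ x → ∃ λ y → y * y ≈ x
    -- Monic polynomials of odd degree have a root.
    oddRoot         : ∀ d (a : Fin (suc (2 ℕ.* d)) → Carrier) →
                      ∃ λ x → x ^ suc (2 ℕ.* d) + sum (λ i → a i * x ^ toℕ i) ≈ 0#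

  open IsDecTotalOrder isDecTotalOrder public using () renaming (_≟_ to _≈?_)

------------------------------------------------------------------------
-- Spectra

module Spectra {c ℓ₁ ℓ₂} (K : RealClosedField c ℓ₁ ℓ₂) where
  open RealClosedField K

  ⟦_⟧ : ℕ → Carrier
  ⟦ n ⟧ = n · 1#

  Matrix : ℕ → Set c
  Matrix n = Fin n → Fin n → Carrier

  -- Laplace expansion along the first row.
  det : ∀ {n} → Matrix n → Carrier
  det {zero}  M = 1#
  det {suc n} M = sum λ j →
    (- 1#) ^ toℕ j * (M zero j * det (λ a → removeAt (M (suc a)) j))

  I : ∀ {n} → Matrix n
  I a b = if does (a ≟ b) then 1# else 0#

  charPoly : ∀ {n} → Matrix n → Carrier → Carrier
  charPoly M x = det λ a b → x * I a b - M a b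

  -- λs lists, with multiplicity, all the roots of the monic polynomial
  -- function f, i.e. f splits as the product of the x - λ.  Since K is
  -- infinite, equality at all points is equality of polynomials.
  RootsOf : (Carrier → Carrier) → List Carrier → Set (c ⊔ ℓ₁)
  RootsOf f λs = ∀ x → f x ≈ foldr (λ μ y → (x - μ) * y) 1# λs

  IsSpectrum : ∀ {n} → Matrix n → List Carrier → Set (c ⊔ ℓ₁)
  IsSpectrum M λs = RootsOf (charPoly M) λs

  Q : ∀ {n} → Graph n → Matrix n
  Q X a b = ⟦ degree X a ⟧ * I a b + (if does (adj? X a b) then 1# else 0#)

  remove : Carrier → List Carrier → List Carrier
  remove μ []       = []
  remove μ (ν ∷ νs) = if does (μ ≈? ν) then νs else ν ∷ remove μ νs

  -- Multiset difference.
  infixl 5 _∖_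
  _∖_ : List Carrier → List Carrier → List Carrier
  νs ∖ μs = foldl (λ ks μ → remove μ ks) νs μs

{-# OPTIONS --safe #-}

-- With y = x - 2r₂ - 2, each block of x I - Q(G) belonging to a pocket is B = (x - 2) I - Q(H₂), and
-- B 1 = y 1.  A Schur complement at these blocks leaves a matrix indexed by the vertices of F whose
-- entries depend only on whether two vertices are equal or lie on the same matching edge.  Two uses of
-- Sylvester's identity t^r det(t I - U V) = t^n det(t I - V U) reduce it first to a k × k matrix
-- b I - 2y J and then to a scalar, so that
--
--   charPoly Q(G) = (x - ω)^k β^(k-1) α g^k   with   det B = y g,
--
-- where ω is the eigenvalue (ii) and α, β are the quadratics of (iii) and (iv).  The factors y, x - ω
-- and β that have to be cancelled vanish at finitely many points only, and both sides are polynomials.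
-- Pasting H on the edge of K₂ gives back H, so the case k = 1 reads
-- charPoly Q(H) = (x - (m-2)) (x - ζ) (x - η) g: the roots of g are the other eigenvalues of Q(H).

module Submission where

open import Defs
open import Algebra.Bundles using (CommutativeRing)
open import Algebra.Solver.Ring.AlmostCommutativeRing
  using (_-Raw-AlmostCommutative⟶_; fromCommutativeRing)
import Algebra.Properties.Ring as RingProperties
import Algebra.Properties.Semiring.Mult.TCOptimised as Mult
import Algebra.Solver.Ring as RingSolver
open import Data.Bool.Base using (true; false; if_then_else_)
open import Data.Fin.Base
  using (Fin; zero; suc; toℕ; punchIn; punchOut; combine; remQuot; _↑ˡ_; _↑ʳ_; splitAt; join; lift)
open import Data.Fin.Permutation using (permutation)
open import Data.Fin.Properties
  using (_≟_; suc-injective; toℕ-↑ˡ; punchIn-punchOut; punchInᵢ≢i; punchIn-injective; splitAt-↑ˡ; splitAt-↑ʳ;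
         splitAt-join; join-splitAt; ↑ˡ-injective; ↑ʳ-injective; combine-remQuot; combine-injective)
open import Data.Integer.Base as ℤ using (ℤ; +_; -[1+_]; _⊖_)
import Data.Integer.Properties as ℤ
open import Data.List.Base
  using (List; []; _∷_; _++_; concatMap; replicate; foldr; length; filter; tabulate)
open import Data.List.Relation.Unary.All as All using (All; []; _∷_)
open import Data.Maybe.Base using (map)
open import Data.Nat.Base as ℕ using (ℕ; zero; suc; _∸_; s≤s)
import Data.Nat.Properties as ℕ
open import Data.Product.Base using (∃; ∃₂; _×_; _,_; proj₁; proj₂)
open import Data.Sum.Base using (inj₁; inj₂; [_,_]′) renaming (swap to swap⊎)
open import Data.Sum.Properties using (swap-involutive)
open import Data.Unit.Polymorphic.Base using (⊤; tt)
open import Data.Vec.Functional using (Vector; tail; removeAt; insertAt; updateAt) renaming (_∷_ to _◂_)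
open import Data.Vec.Functional.Properties
  using (insertAt-lookup; insertAt-punchIn; updateAt-updates; updateAt-minimal)
open import Function.Base using (_∘_; const; _$_; id)
open import Level using (_⊔_; 0ℓ)
open import Relation.Binary.Consequences using (dec⇒weaklyDec)
open import Relation.Binary.Definitions using (WeaklyDecidable)
open import Relation.Binary.PropositionalEquality as ≡ using (_≡_; _≢_; _≗_)
open import Relation.Binary.Structures using (IsDecTotalOrder)
open import Relation.Nullary.Decidable using (Dec; does; yes; no; dec-true; dec-false; _×-dec_)
open import Relation.Nullary.Negation using (¬_; contradiction)
open import Relation.Unary using (Pred; Decidable)

-- Nothing is inverted. Both ends of a pasted edge are adjacent to its whole pocket, so the columns
-- coupling a pocket to `F` are multiples of the all-ones vector; there `B` acts as the scalar `y`,
-- and powers of `y` replace the inverse of `B`. With `W` the vertex-edge incidence matrix of the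
-- matching and `p = m - 2`, the reduced matrix is `s I - y J - p W Wᵀ`, where `s = y (x - ω)`. Each
-- edge has two ends and each vertex one edge, so `Wᵀ W = 2 I`: this gives `b = s - 2p`, which is
-- `β`, and the rank-one part turns it into `b - 2yk`, which is `α`. Since `n = 2k`, the factor
-- `y^n` is matched exactly by `y^k` from `s^k` and `y^k` from `(det B)^k`. Spectra are lists,
-- compared through the values of polynomial functions at all points. Hence `det B / y` must make
-- sense also where `y = 0`, which a bordered determinant achieves, and the given list for `H` has
-- to be divided one linear factor at a time. The roots of `g` are the `q_j(H₂) + 2` with one copy
-- of `2r₂ + 2` left out, yet no eigenvector of `H` is used.

-- Ring identities with integer coefficients

-- With coefficients in ℤ, unlike those in the ring itself, the solver can decide that 1 - 1 is 0.
module IntegerCoefficients {c ℓ} (R : CommutativeRing c ℓ) where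
  open CommutativeRing R
  open Mult semiring renaming (_×_ to _·_)
  open RingProperties ring
  open import Relation.Binary.Reasoning.Setoid setoid
  open import Algebra.Properties.CommutativeSemigroup +-commutativeSemigroup using (interchange)

  fromℤ : ℤ → Carrier
  fromℤ (+ n)    = n · 1#
  fromℤ -[1+ n ] = - (suc n · 1#)

  fromℤ-⊖ : ∀ m n → fromℤ (m ⊖ n) ≈ m · 1# - n · 1#
  fromℤ-⊖ zero    zero    = sym (-‿inverseʳ 0#)
  fromℤ-⊖ zero    (suc n) = sym (+-identityˡ _)
  fromℤ-⊖ (suc m) zero    = sym (trans (+-congˡ -0#≈0#) (+-identityʳ _))
  fromℤ-⊖ (suc m) (suc n) = begin
    fromℤ (suc m ⊖ suc n)               ≡⟨ ≡.cong fromℤ (ℤ.[1+m]⊖[1+n]≡m⊖n m n) ⟩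
    fromℤ (m ⊖ n)                       ≈⟨ fromℤ-⊖ m n ⟩
    m · 1# - n · 1#                     ≈⟨ +-identityˡ _ ⟨
    0# + (m · 1# - n · 1#)              ≈⟨ +-congʳ (-‿inverseʳ 1#) ⟨
    (1# - 1#) + (m · 1# - n · 1#)       ≈⟨ interchange _ _ _ _ ⟩
    (1# + m · 1#) + (- 1# - n · 1#)     ≈⟨ +-congˡ (-‿+-comm 1# (n · 1#)) ⟩
    (1# + m · 1#) - (1# + n · 1#)       ≈⟨ +-cong (×-homo-+ 1# 1 m) (-‿cong (×-homo-+ 1# 1 n)) ⟨
    suc m · 1# - suc n · 1#             ∎

  fromℤ-+ : ∀ i j → fromℤ (i ℤ.+ j) ≈ fromℤ i + fromℤ j
  fromℤ-+ (+ m)    (+ n)    = ×-homo-+ 1# m n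
  fromℤ-+ (+ m)    -[1+ n ] = fromℤ-⊖ m (suc n)
  fromℤ-+ -[1+ m ] (+ n)    = trans (fromℤ-⊖ n (suc m)) (+-comm _ _)
  fromℤ-+ -[1+ m ] -[1+ n ] = begin
    - (suc (suc (m ℕ.+ n)) · 1#)        ≡⟨ ≡.cong (λ l → - (suc l · 1#)) (ℕ.+-suc m n) ⟨
    - ((suc m ℕ.+ suc n) · 1#)          ≈⟨ -‿cong (×-homo-+ 1# (suc m) (suc n)) ⟩
    - (suc m · 1# + suc n · 1#)         ≈⟨ -‿+-comm _ _ ⟨
    - (suc m · 1#) - suc n · 1#         ∎

  fromℤ-neg : ∀ i → fromℤ (ℤ.- i) ≈ - fromℤ i
  fromℤ-neg (+ zero)  = sym -0#≈0#
  fromℤ-neg (+ suc n) = refl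
  fromℤ-neg -[1+ n ]  = sym (-‿involutive _)

  fromℤ-*⁺ : ∀ m j → fromℤ (+ m ℤ.* j) ≈ m · 1# * fromℤ j
  fromℤ-*⁺ m (+ n) = begin
    fromℤ (+ m ℤ.* + n)             ≡⟨ ≡.cong fromℤ (ℤ.pos-* m n) ⟨
    (m ℕ.* n) · 1#                  ≈⟨ ×1-homo-* m n ⟩
    m · 1# * n · 1#                 ∎
  fromℤ-*⁺ m -[1+ n ] = begin
    fromℤ (+ m ℤ.* -[1+ n ])        ≡⟨ ≡.cong fromℤ (ℤ.neg-distribʳ-* (+ m) (+ suc n)) ⟨
    fromℤ (ℤ.- (+ m ℤ.* + suc n))   ≈⟨ fromℤ-neg (+ m ℤ.* + suc n) ⟩
    - fromℤ (+ m ℤ.* + suc n)       ≈⟨ -‿cong (fromℤ-*⁺ m (+ suc n)) ⟩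
    - (m · 1# * suc n · 1#)         ≈⟨ -‿distribʳ-* _ _ ⟩
    m · 1# * - (suc n · 1#)         ∎

  fromℤ-* : ∀ i j → fromℤ (i ℤ.* j) ≈ fromℤ i * fromℤ j
  fromℤ-* (+ m)    j = fromℤ-*⁺ m j
  fromℤ-* -[1+ m ] j = begin
    fromℤ (-[1+ m ] ℤ.* j)          ≡⟨ ≡.cong fromℤ (ℤ.neg-distribˡ-* (+ suc m) j) ⟨
    fromℤ (ℤ.- (+ suc m ℤ.* j))     ≈⟨ fromℤ-neg (+ suc m ℤ.* j) ⟩
    - fromℤ (+ suc m ℤ.* j)         ≈⟨ -‿cong (fromℤ-*⁺ (suc m) j) ⟩
    - (suc m · 1# * fromℤ j)        ≈⟨ -‿distribˡ-* _ _ ⟩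
    - (suc m · 1#) * fromℤ j        ∎

  homomorphism : ℤ.+-*-rawRing -Raw-AlmostCommutative⟶ fromCommutativeRing R
  homomorphism = record
    { ⟦_⟧    = fromℤ
    ; +-homo = fromℤ-+
    ; *-homo = fromℤ-*
    ; -‿homo = fromℤ-neg
    ; 0-homo = refl
    ; 1-homo = refl
    }

  fromℤ≟ : WeaklyDecidable (λ i j → fromℤ i ≈ fromℤ j)
  fromℤ≟ i j = map (λ eq → reflexive (≡.cong fromℤ eq)) (dec⇒weaklyDec ℤ._≟_ i j)

  open RingSolver ℤ.+-*-rawRing (fromCommutativeRing R) homomorphism fromℤ≟ public
    using (solve; _:=_; _:+_; _:*_; _:-_; :-_; con)

-- Index arithmetic for minors and blocks

punchIn-elim : ∀ {n ℓ} (i : Fin (suc n)) {P : Fin (suc n) → Set ℓ} →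
               P i → (∀ j → P (punchIn i j)) → ∀ j → P j
punchIn-elim i {P} pᵢ p j with i ≟ j
... | yes ≡.refl = pᵢ
... | no i≢j     = ≡.subst P (punchIn-punchOut i≢j) (p (punchOut i≢j))

-- Deleting a column of the first block is compatible with the embeddings of both blocks, so the
-- minors met in the Laplace expansion of a block matrix are block matrices again.
punchIn-↑ˡ-↑ˡ : ∀ {n} q (j : Fin (suc n)) i → punchIn (j ↑ˡ q) (i ↑ˡ q) ≡ punchIn j i ↑ˡ q
punchIn-↑ˡ-↑ˡ q zero    i       = ≡.refl
punchIn-↑ˡ-↑ˡ q (suc j) zero    = ≡.refl
punchIn-↑ˡ-↑ˡ q (suc j) (suc i) = ≡.cong suc (punchIn-↑ˡ-↑ˡ q j i)

punchIn-↑ˡ-↑ʳ : ∀ {n} q (j : Fin (suc n)) (i : Fin q) → punchIn (j ↑ˡ q) (n ↑ʳ i) ≡ suc n ↑ʳ i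
punchIn-↑ˡ-↑ʳ         q zero    i = ≡.refl
punchIn-↑ˡ-↑ʳ {suc n} q (suc j) i = ≡.cong suc (punchIn-↑ˡ-↑ʳ q j i)

combine-elim : ∀ {k p ℓ} {P : Fin (k ℕ.* p) → Set ℓ} → (∀ i w → P (combine {k} {p} i w)) → ∀ j → P j
combine-elim {k} {p} {P = P} f j = ≡.subst P (combine-remQuot {k} p j) (f _ _)

↑ˡ≢↑ʳ : ∀ {m n} {i : Fin m} {j : Fin n} → i ↑ˡ n ≢ m ↑ʳ j
↑ˡ≢↑ʳ {m} {n} {i} {j} eq with ≡.trans (≡.sym (splitAt-↑ˡ m i n)) (≡.trans (≡.cong (splitAt m) eq) (splitAt-↑ʳ m n j))
... | ()

-- Vertices and adjacency of the pasted graph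

module Pocket {p} (P : EdgePocket p) where
  open EdgePocket P

  inner-injective : ∀ {w x} → inner w ≡ inner x → w ≡ x
  inner-injective = punchIn-injective (punchOut u≢v) _ _ ∘ punchIn-injective u _ _

  inner-outer : ∀ {w} (u≢w : u ≢ w) (v≢w : v ≢ w) → inner (outer u≢w v≢w) ≡ w
  inner-outer u≢w v≢w = ≡.trans (≡.cong (punchIn u) (punchIn-punchOut _)) (punchIn-punchOut u≢w)

  u≢inner : ∀ w → u ≢ inner w
  u≢inner w eq = punchInᵢ≢i u _ (≡.sym eq)

  v≢inner : ∀ w → v ≢ inner w
  v≢inner w eq = punchInᵢ≢i (punchOut u≢v) w
    (≡.sym (punchIn-injective u _ _ (≡.trans (punchIn-punchOut u≢v) eq)))

  data View : Fin (2 ℕ.+ p) → Set where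
    is-u     : View u
    is-v     : View v
    is-inner : ∀ w → View (inner w)

  view : ∀ x → View x
  view x with u ≟ x | v ≟ x
  ... | yes ≡.refl | _        = is-u
  ... | no _     | yes ≡.refl = is-v
  ... | no u≢x   | no v≢x   = ≡.subst View (inner-outer u≢x v≢x) (is-inner _)

  module Pasted {n k} (F : Graph n) (E : EdgeSet F k) where
    open EdgeSet E
    open Pasting F E P

    fromH-u : ∀ i → fromH i u ≡ fromF (src i)
    fromH-u i with u ≟ u
    ... | yes _  = ≡.refl
    ... | no u≢u = contradiction ≡.refl u≢u

    fromH-v : ∀ i → fromH i v ≡ fromF (tgt i)
    fromH-v i with u ≟ v | v ≟ v
    ... | yes u≡v | _      = contradiction u≡v u≢v
    ... | no _    | yes _  = ≡.refl
    ... | no _    | no v≢v = contradiction ≡.refl v≢v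

    fromH-inner : ∀ i w → fromH i (inner w) ≡ fromInner i w
    fromH-inner i w with u ≟ inner w | v ≟ inner w
    ... | yes u≡ | _      = contradiction u≡ (u≢inner w)
    ... | no _   | yes v≡ = contradiction v≡ (v≢inner w)
    ... | no u≢  | no v≢  = ≡.cong (fromInner i) (inner-injective (inner-outer u≢ v≢))

    fromF-injective : ∀ {a b} → fromF a ≡ fromF b → a ≡ b
    fromF-injective = ↑ˡ-injective (k ℕ.* p) _ _

    fromInner-injective : ∀ {i j w x} → fromInner i w ≡ fromInner j x → i ≡ j × w ≡ x
    fromInner-injective {i} {j} {w} {x} eq = combine-injective i w j x (↑ʳ-injective n _ _ eq)

    fromH≡fromF : ∀ {i x a} → fromH i x ≡ fromF a → a IsEndOf i
    fromH≡fromF {i} {x} eq with view x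
    ... | is-u       = inj₁ (≡.sym (fromF-injective (≡.trans (≡.sym (fromH-u i)) eq)))
    ... | is-v       = inj₂ (≡.sym (fromF-injective (≡.trans (≡.sym (fromH-v i)) eq)))
    ... | is-inner w = contradiction (≡.trans (≡.sym eq) (fromH-inner i w)) ↑ˡ≢↑ʳ

    fromH≡fromInner : ∀ {i j x w} → fromH i x ≡ fromInner j w → i ≡ j × x ≡ inner w
    fromH≡fromInner {i} {j} {x} {w} eq with view x
    ... | is-u       = contradiction (≡.trans (≡.sym (fromH-u i)) eq) ↑ˡ≢↑ʳ
    ... | is-v       = contradiction (≡.trans (≡.sym (fromH-v i)) eq) ↑ˡ≢↑ʳ
    ... | is-inner _ with fromInner-injective (≡.trans (≡.sym (fromH-inner i _)) eq)
    ...   | i≡j , w≡x = i≡j , ≡.cong inner w≡x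

    Adj-inner : ∀ {i j w x} → Adj G (fromInner i w) (fromInner j x) → i ≡ j × Adj H-uv w x
    Adj-inner (inj₁ (_ , _ , eq , _ , _)) = contradiction eq ↑ˡ≢↑ʳ
    Adj-inner (inj₂ (l , a , b , eqᵃ , eqᵇ , ab)) with fromH≡fromInner eqᵃ | fromH≡fromInner eqᵇ
    ... | ≡.refl , ≡.refl | ≡.refl , ≡.refl = ≡.refl , ab

    inner-Adj : ∀ {i j w x} → i ≡ j × Adj H-uv w x → Adj G (fromInner i w) (fromInner j x)
    inner-Adj {i} (≡.refl , wx) = inj₂ (i , inner _ , inner _ , fromH-inner i _ , fromH-inner i _ , wx)

    -- An edge of `F` never reaches an inner vertex, so the adjacency comes from a copy of `H`; the
    -- inner end determines which copy.
    Adj-end : ∀ {a i w} → Adj G (fromF a) (fromInner i w) → a IsEndOf i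
    Adj-end (inj₁ (_ , _ , _ , eq , _)) = contradiction eq ↑ˡ≢↑ʳ
    Adj-end (inj₂ (l , a , b , eqᵃ , eqᵇ , ab)) with fromH≡fromInner eqᵇ
    ... | ≡.refl , ≡.refl = fromH≡fromF eqᵃ

    end-Adj : (∀ w → Adj H u (inner w)) → (∀ w → Adj H v (inner w)) →
              ∀ {a i w} → a IsEndOf i → Adj G (fromF a) (fromInner i w)
    end-Adj uH vH {i = i} {w} (inj₁ ≡.refl) = inj₂ (i , u , inner w , fromH-u i , fromH-inner i w , uH w)
    end-Adj uH vH {i = i} {w} (inj₂ ≡.refl) = inj₂ (i , v , inner w , fromH-v i , fromH-inner i w , vH w)

-- The pocket itself as a pasting on the complete graph with two vertices

K₂-edge : EdgeSet (complete 2) 1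
K₂-edge = record
  { src      = λ _ → zero
  ; tgt      = λ _ → suc zero
  ; edge     = λ _ ()
  ; distinct = λ { {zero} {zero} i≢j → contradiction ≡.refl i≢j }
  }

K₂-edge-perfect : EdgeSet.IsPerfectMatching K₂-edge
K₂-edge-perfect zero       = zero , inj₁ ≡.refl , λ { {zero} _ → ≡.refl }
K₂-edge-perfect (suc zero) = zero , inj₂ ≡.refl , λ { {zero} _ → ≡.refl }

module Single {p} (P : EdgePocket p) where
  open EdgePocket P
  open Pocket P
  open Pasted (complete 2) K₂-edge
  open Pasting (complete 2) K₂-edge P

  toSingle : Fin (2 ℕ.+ p) → Fin order
  toSingle = fromH zero

  fromSingle : Fin order → Fin (2 ℕ.+ p)
  fromSingle zero          = u
  fromSingle (suc zero)    = v
  fromSingle (suc (suc j)) = inner (proj₂ (remQuot {1} p j))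

  to∘from : ∀ j → toSingle (fromSingle j) ≡ j
  to∘from zero          = fromH-u zero
  to∘from (suc zero)    = fromH-v zero
  -- `fromH-inner` yields copy number `zero`, whereas `remQuot` returns a neutral element of
  -- `Fin 1`; `only` identifies the two.
  to∘from (suc (suc j)) = ≡.trans (fromH-inner zero _)
    (≡.cong (2 ↑ʳ_) (≡.trans (only (proj₁ (remQuot {1} p j)) _) (combine-remQuot {1} p j)))
    where
    only : ∀ (i : Fin 1) w → combine {1} {p} zero w ≡ combine i w
    only zero w = ≡.refl

  from∘to : ∀ x → fromSingle (toSingle x) ≡ x
  from∘to x = fromH-injective zero (to∘from (toSingle x))

  -- The edge of `K₂` is pasted to `uv`, which is already an edge of `H`, so the pasting creates no
  -- new adjacency.
  Adj-Single : ∀ {a b} → Adj G (toSingle a) (toSingle b) → Adj H a b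
  Adj-Single (inj₁ (zero     , zero     , _ , _ , 0≢0)) = contradiction ≡.refl 0≢0
  Adj-Single (inj₁ (suc zero , suc zero , _ , _ , 1≢1)) = contradiction ≡.refl 1≢1
  Adj-Single (inj₁ (zero     , suc zero , a , b , _))   = ≡.subst₂ (Adj H)
    (fromH-injective zero (≡.trans (fromH-u zero) a)) (fromH-injective zero (≡.trans (fromH-v zero) b)) uv
  Adj-Single (inj₁ (suc zero , zero     , b , a , _))   = ≡.subst₂ (Adj H)
    (fromH-injective zero (≡.trans (fromH-v zero) b)) (fromH-injective zero (≡.trans (fromH-u zero) a)) (symm H uv)
  Adj-Single (inj₂ (zero , _ , _ , a , b , ab))         = ≡.subst₂ (Adj H)
    (fromH-injective zero a) (fromH-injective zero b) ab

  Single-Adj : ∀ {a b} → Adj H a b → Adj G (toSingle a) (toSingle b)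
  Single-Adj ab = inj₂ (zero , _ , _ , ≡.refl , ≡.refl , ab)

-- Finite sums and the identity matrix

module LinearAlgebra {c ℓ₁ ℓ₂} (K : RealClosedField c ℓ₁ ℓ₂) where
  open RealClosedField K
  open Spectra K
  open CommutativeRing commutativeRing public using (refl; sym; trans)
  open IntegerCoefficients commutativeRing public
  open import Algebra.Properties.Ring ring public
    using (-0#≈0#; x∙y⁻¹≈ε⇒x≈y; x≈y⇒x∙y⁻¹≈ε)
  open import Algebra.Properties.Semiring.Sum semiring as Sum using ()
  open import Relation.Binary.Reasoning.Setoid setoid

  -- Opaque, so that unification does not unfold them and can solve for their arguments.
  opaque
    ∑ : ∀ {n} → Vector Carrier n → Carrier
    ∑ = sum

    Det : ∀ {n} → Matrix n → Carrier
    Det = det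

  sign : ∀ {n} → Fin n → Carrier
  sign j = (- 1#) ^ toℕ j

  -- The first row is kept apart from the others because the two play different parts: linearity in
  -- `v` is that of a sum, alternation in `R` is inherited from the minors.
  laplace : ∀ {n} → Vector Carrier (suc n) → (Fin n → Vector Carrier (suc n)) → Carrier
  laplace v R = ∑ λ j → sign j * (v j * Det (λ a → removeAt (R a) j))

  opaque
    unfolding ∑ Det

    charPoly≡Det : ∀ {n} (M : Matrix n) x → charPoly M x ≡ Det λ a b → x * I a b - M a b
    charPoly≡Det M x = ≡.refl

    Det-zero : ∀ M → Det {zero} M ≈ 1#
    Det-zero M = refl

    Det-suc : ∀ {n} (M : Matrix (suc n)) → Det M ≈ laplace (M zero) (tail M)
    Det-suc M = refl

    ∑-zero : ∀ (f : Vector Carrier 0) → ∑ f ≈ 0#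
    ∑-zero f = refl

    ∑-suc : ∀ {n} (f : Vector Carrier (suc n)) → ∑ f ≈ f zero + ∑ (f ∘ suc)
    ∑-suc f = refl

    ∑-cong : ∀ {n} {f g : Vector Carrier n} → (∀ i → f i ≈ g i) → ∑ f ≈ ∑ g
    ∑-cong = Sum.sum-cong-≋

    ∑-const : ∀ n x → ∑ {n} (λ _ → x) ≈ n · x
    ∑-const n x = Sum.sum-replicate n

    ∑-distrib-+ : ∀ {n} (f g : Vector Carrier n) → ∑ (λ i → f i + g i) ≈ ∑ f + ∑ g
    ∑-distrib-+ = Sum.∑-distrib-+

    *-distribˡ-∑ : ∀ {n} x (f : Vector Carrier n) → x * ∑ f ≈ ∑ (λ i → x * f i)
    *-distribˡ-∑ = Sum.*-distribˡ-sum

    *-distribʳ-∑ : ∀ {n} x (f : Vector Carrier n) → ∑ f * x ≈ ∑ (λ i → f i * x)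
    *-distribʳ-∑ = Sum.*-distribʳ-sum

    ∑-reindex : ∀ {m n} (π : Fin m → Fin n) (π⁻¹ : Fin n → Fin m) →
                (∀ a → π (π⁻¹ a) ≡ a) → (∀ a → π⁻¹ (π a) ≡ a) →
                ∀ f → ∑ f ≈ ∑ (f ∘ π)
    ∑-reindex π π⁻¹ ππ⁻¹ π⁻¹π f = Sum.sum-permute f (permutation π π⁻¹ ππ⁻¹ π⁻¹π)

    ∑-++ : ∀ n q (f : Vector Carrier (n ℕ.+ q)) → ∑ f ≈ ∑ (f ∘ (_↑ˡ q)) + ∑ (f ∘ (n ↑ʳ_))
    ∑-++ zero    q f = sym (+-identityˡ _)
    ∑-++ (suc n) q f = trans (+-congˡ (∑-++ n q (f ∘ suc))) (sym (+-assoc _ _ _))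

  ∑-0 : ∀ {n} {f : Vector Carrier n} → (∀ i → f i ≈ 0#) → ∑ f ≈ 0#
  ∑-0 {n} f≈0 = trans (∑-cong f≈0) (trans (∑-const n 0#) (·0 n))
    where
    ·0 : ∀ n → n · 0# ≈ 0#
    ·0 zero    = refl
    ·0 (suc n) = trans (+-identityˡ _) (·0 n)

  ∑-neg : ∀ {n} (f : Vector Carrier n) → ∑ (λ j → - f j) ≈ - ∑ f
  ∑-neg f = begin
    ∑ (λ j → - f j)          ≈⟨ ∑-cong (λ j → solve 1 (λ x → :- x := (:- con (+ 1)) :* x) refl (f j)) ⟩
    ∑ (λ j → (- 1#) * f j)   ≈⟨ *-distribˡ-∑ (- 1#) f ⟨
    (- 1#) * ∑ f             ≈⟨ solve 1 (λ x → (:- con (+ 1)) :* x := :- x) refl (∑ f) ⟩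
    - ∑ f                    ∎

  ∑-distrib-minus : ∀ {n} (f g : Vector Carrier n) → ∑ (λ i → f i - g i) ≈ ∑ f - ∑ g
  ∑-distrib-minus f g = trans (∑-distrib-+ f _) (+-congˡ (∑-neg g))

  ∑-1 : ∀ n → ∑ {n} (λ _ → 1#) ≈ ⟦ n ⟧
  ∑-1 n = ∑-const n 1#

  ∑-constˡ : ∀ n x → ∑ {n} (λ _ → x) ≈ x * ⟦ n ⟧
  ∑-constˡ n x = begin
    ∑ {n} (λ _ → x)         ≈⟨ ∑-cong (λ _ → *-identityʳ x) ⟨
    ∑ {n} (λ _ → x * 1#)    ≈⟨ *-distribˡ-∑ x _ ⟨
    x * ∑ {n} (λ _ → 1#)    ≈⟨ *-congˡ (∑-1 n) ⟩
    x * ⟦ n ⟧               ∎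

  ∑-combine : ∀ k p (f : Vector Carrier (k ℕ.* p)) →
              ∑ f ≈ ∑ {k} λ i → ∑ {p} λ w → f (combine i w)
  ∑-combine zero    p f = trans (∑-zero f) (sym (∑-zero _))
  ∑-combine (suc k) p f = begin
    ∑ f                                                     ≈⟨ ∑-++ p (k ℕ.* p) f ⟩
    ∑ (f ∘ (_↑ˡ (k ℕ.* p))) + ∑ (f ∘ (p ↑ʳ_))               ≈⟨ +-congˡ (∑-combine k p (f ∘ (p ↑ʳ_))) ⟩
    _                                                       ≈⟨ ∑-suc _ ⟨
    ∑ (λ i → ∑ λ w → f (combine {suc k} {p} i w))           ∎

  I-diag : ∀ {n} (i : Fin n) → I i i ≈ 1#
  I-diag i rewrite dec-true (i ≟ i) ≡.refl = refl

  I-off : ∀ {n} {i j : Fin n} → i ≢ j → I i j ≈ 0#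
  I-off {i = i} {j} i≢j rewrite dec-false (i ≟ j) i≢j = refl

  I-sym : ∀ {n} (i j : Fin n) → I i j ≈ I j i
  I-sym i j with i ≟ j
  ... | yes ≡.refl = sym (I-diag i)
  ... | no i≢j     = sym (I-off (i≢j ∘ ≡.sym))

  I-injective : ∀ {n n′} (π : Fin n′ → Fin n) → (∀ {a b} → π a ≡ π b → a ≡ b) →
                ∀ a b → I (π a) (π b) ≈ I a b
  I-injective π π-inj a b with a ≟ b
  ... | yes ≡.refl = I-diag (π a)
  ... | no a≢b     = I-off (a≢b ∘ π-inj)

  ∑-Iˡ : ∀ {n} (i : Fin n) (f : Vector Carrier n) → ∑ (λ j → I i j * f j) ≈ f i
  ∑-Iˡ zero    f = begin
    ∑ (λ j → I zero j * f j)                  ≈⟨ ∑-suc _ ⟩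
    1# * f zero + ∑ (λ j → 0# * f (suc j))    ≈⟨ +-cong (*-identityˡ _) (∑-0 λ _ → zeroˡ _) ⟩
    f zero + 0#                               ≈⟨ +-identityʳ _ ⟩
    f zero                                    ∎
  ∑-Iˡ (suc i) f = begin
    ∑ (λ j → I (suc i) j * f j)                  ≈⟨ ∑-suc _ ⟩
    0# * f zero + ∑ (λ j → I i j * f (suc j))    ≈⟨ +-cong (zeroˡ _) (∑-Iˡ i (f ∘ suc)) ⟩
    0# + f (suc i)                               ≈⟨ +-identityˡ _ ⟩
    f (suc i)                                    ∎

  ∑-Iʳ : ∀ {n} (i : Fin n) (f : Vector Carrier n) → ∑ (λ j → f j * I j i) ≈ f i
  ∑-Iʳ i f = trans (∑-cong λ j → trans (*-comm _ _) (*-congʳ (I-sym j i))) (∑-Iˡ i f)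

  -- Alternating functions of the rows of a matrix

  infix 4 _≋_
  _≋_ : ∀ {n} → Vector Carrier n → Vector Carrier n → Set ℓ₁
  v ≋ w = ∀ b → v b ≈ w b

  -- The number of rows is independent of their length, so that fixing the first row of `suc n` rows
  -- leaves a function of `n` rows of the same length.
  Rows : ℕ → ℕ → Set c
  Rows n N = Fin n → Vector Carrier N

  -- `linear` compares three matrices that agree off row `i` instead of updating one of them, so
  -- that it applies directly to matrices given by formulas.
  record IsAlternating {n N} (f : Rows n N → Carrier) : Set (c ⊔ ℓ₁) where
    field
      cong   : ∀ {M M′} → (∀ a → M a ≋ M′ a) → f M ≈ f M′
      linear : ∀ i {M M′ M″} x y →
               (∀ a → a ≢ i → M a ≋ M′ a) → (∀ a → a ≢ i → M a ≋ M″ a) →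
               (∀ b → M i b ≈ x * M′ i b + y * M″ i b) →
               f M ≈ x * f M′ + y * f M″
      alt    : ∀ {i j M} → i ≢ j → M i ≋ M j → f M ≈ 0#

  ◂-cong : ∀ {n N} {v v′ : Vector Carrier N} {R R′ : Rows n N} → v ≋ v′ → (∀ a → R a ≋ R′ a) →
           ∀ a → (v ◂ R) a ≋ (v′ ◂ R′) a
  ◂-cong v≋v′ R≋R′ zero    = v≋v′
  ◂-cong v≋v′ R≋R′ (suc a) = R≋R′ a

  ◂-tail : ∀ {n N} (M : Rows (suc n) N) → ∀ a → M a ≋ (M zero ◂ tail M) a
  ◂-tail M zero    b = refl
  ◂-tail M (suc a) b = refl

  -- Rows are exchanged one at a time: once the first row has been replaced it becomes a parameter,
  -- and the induction runs over the others. The relation is left open because the clearing of a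
  -- column uses agreement off that column.
  rowwise : ∀ {n N} (f : Rows n N → Carrier) → (∀ {M M′} → (∀ a → M a ≋ M′ a) → f M ≈ f M′) →
            (_~_ : Vector Carrier N → Vector Carrier N → Set ℓ₁) →
            (∀ i {M M′} → (∀ a → a ≢ i → M a ≋ M′ a) → M i ~ M′ i → f M ≈ f M′) →
            ∀ {M M′} → (∀ a → M a ~ M′ a) → f M ≈ f M′
  rowwise {zero}  f f-cong _~_ step M~M′ = f-cong λ ()
  rowwise {suc n} f f-cong _~_ step {M} {M′} M~M′ = begin
    f M                     ≈⟨ step zero off (M~M′ zero) ⟩
    f (M′ zero ◂ tail M)    ≈⟨ rowwise (λ R → f (M′ zero ◂ R))
                                 (λ eq → f-cong (◂-cong (λ _ → refl) eq)) _~_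
                                 (λ i {R} {R′} eq → step (suc i) (off′ eq))
                                 (M~M′ ∘ suc) ⟩
    f (M′ zero ◂ tail M′)   ≈⟨ f-cong (◂-tail M′) ⟨
    f M′                    ∎
    where
    off : ∀ a → a ≢ zero → M a ≋ (M′ zero ◂ tail M) a
    off zero    a≢0 = contradiction ≡.refl a≢0
    off (suc a) _   = λ _ → refl
    off′ : ∀ {i} {R R′ : Rows n _} → (∀ a → a ≢ i → R a ≋ R′ a) →
           ∀ a → a ≢ suc i → (M′ zero ◂ R) a ≋ (M′ zero ◂ R′) a
    off′ eq zero    _  = λ _ → refl
    off′ eq (suc a) a≢ = eq a (a≢ ∘ ≡.cong suc)

  module _ {n N} {f : Rows (suc n) N → Carrier} (F : IsAlternating f) where
    open IsAlternating F

    ◂-alternating : ∀ v → IsAlternating (λ R → f (v ◂ R))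
    ◂-alternating v = record
      { cong   = λ eq → cong (◂-cong (λ _ → refl) eq)
      ; linear = λ i x y eq′ eq″ → linear (suc i) x y (off eq′) (off eq″)
      ; alt    = λ i≢j → alt (i≢j ∘ suc-injective)
      }
      where
      off : ∀ {i} {R R′ : Rows n N} → (∀ a → a ≢ i → R a ≋ R′ a) →
            ∀ a → a ≢ suc i → (v ◂ R) a ≋ (v ◂ R′) a
      off eq zero    _  = λ _ → refl
      off eq (suc a) a≢ = eq a (a≢ ∘ ≡.cong suc)

    head-linear : ∀ {v v′ v″} x y (R : Rows n N) → (∀ b → v b ≈ x * v′ b + y * v″ b) →
                  f (v ◂ R) ≈ x * f (v′ ◂ R) + y * f (v″ ◂ R)
    head-linear x y R eq = linear zero x y off off eq
      where
      off : ∀ {v v′} a → a ≢ zero → (v ◂ R) a ≋ (v′ ◂ R) a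
      off zero    a≢0 = contradiction ≡.refl a≢0
      off (suc a) _   = λ _ → refl

    head-sum : ∀ {J} (x : Vector Carrier J) (w : Rows J N) (R : Rows n N) →
               f ((λ b → ∑ λ j → x j * w j b) ◂ R) ≈ ∑ λ j → x j * f (w j ◂ R)
    head-sum {zero} x w R = begin
      f ((λ b → ∑ λ j → x j * w j b) ◂ R)
        -- The empty sum is the zero vector, written as `0 * 0 + 0 * 0`, so that linearity forces
        -- the value `0`.
        ≈⟨ head-linear {v′ = λ _ → 0#} {v″ = λ _ → 0#} 0# 0# R
             (λ b → trans (∑-zero _) (sym (trans (+-cong (zeroˡ 0#) (zeroˡ 0#)) (+-identityˡ 0#)))) ⟩
      0# * f ((λ _ → 0#) ◂ R) + 0# * f ((λ _ → 0#) ◂ R)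
        ≈⟨ trans (+-cong (zeroˡ _) (zeroˡ _)) (+-identityˡ 0#) ⟩
      0#
        ≈⟨ ∑-zero _ ⟨
      ∑ (λ j → x j * f (w j ◂ R))  ∎
    head-sum {suc J} x w R = begin
      f ((λ b → ∑ λ j → x j * w j b) ◂ R)
        ≈⟨ head-linear (x zero) 1# R (λ b → trans (∑-suc _) (+-congˡ (sym (*-identityˡ _)))) ⟩
      x zero * f (w zero ◂ R) + 1# * f ((λ b → ∑ λ j → x (suc j) * w (suc j) b) ◂ R)
        ≈⟨ +-congˡ (trans (*-identityˡ _) (head-sum (x ∘ suc) (w ∘ suc) R)) ⟩
      x zero * f (w zero ◂ R) + ∑ (λ j → x (suc j) * f (w (suc j) ◂ R))
        ≈⟨ ∑-suc _ ⟨
      ∑ (λ j → x j * f (w j ◂ R))  ∎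

  -- Linearity in row `i` splits off `x` times the value at a matrix whose rows `i` and `j`
  -- coincide.
  add-row : ∀ {n N} {f : Rows n N → Carrier} → IsAlternating f →
            ∀ {i j M M′} x → i ≢ j → (∀ a → a ≢ i → M a ≋ M′ a) →
            (∀ b → M i b ≈ M′ i b + x * M j b) → f M ≈ f M′
  add-row {f = f} F {i} {j} {M} {M′} x i≢j off eq = begin
    f M                   ≈⟨ linear i 1# x off (λ a a≢i b → sym (reflexive (≡.cong (_$ b) (updateAt-minimal a i M a≢i))))
                               (λ b → trans (eq b) (+-cong (sym (*-identityˡ _))
                                  (*-congˡ (sym (reflexive (≡.cong (_$ b) (updateAt-updates i M))))))) ⟩
    1# * f M′ + x * f M″  ≈⟨ +-cong (*-identityˡ _) (*-congˡ (alt i≢j M″ᵢ≋M″ⱼ)) ⟩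
    f M′ + x * 0#         ≈⟨ solve 2 (λ a x → a :+ x :* con (+ 0) := a) refl (f M′) x ⟩
    f M′                  ∎
    where
    open IsAlternating F
    M″ = updateAt M i (const (M j))
    M″ᵢ≋M″ⱼ : M″ i ≋ M″ j
    M″ᵢ≋M″ⱼ b = reflexive (≡.cong (_$ b)
      (≡.trans (updateAt-updates i M) (≡.sym (updateAt-minimal j i M (i≢j ∘ ≡.sym)))))

  -- Polarisation: of the four terms in the expansion of `f` at two equal rows `v + w`, the two with
  -- repeated rows vanish.
  swap-rows : ∀ {n N} {f : Rows (suc (suc n)) N → Carrier} → IsAlternating f →
              ∀ v w R → f (v ◂ w ◂ R) ≈ - f (w ◂ v ◂ R)
  swap-rows {f = f} F v w R = x∙y⁻¹≈ε⇒x≈y _ _ $ begin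
    f (v ◂ w ◂ R) - - f (w ◂ v ◂ R)
      ≈⟨ solve 2 (λ x y → x :- (:- y) := con (+ 1) :* (con (+ 1) :* con (+ 0) :+ con (+ 1) :* x)
                            :+ con (+ 1) :* (con (+ 1) :* y :+ con (+ 1) :* con (+ 0))) refl _ _ ⟩
    1# * (1# * 0# + 1# * f (v ◂ w ◂ R)) + 1# * (1# * f (w ◂ v ◂ R) + 1# * 0#)
      ≈⟨ +-cong (*-congˡ (+-congʳ (*-congˡ (diag v)))) (*-congˡ (+-congˡ (*-congˡ (diag w)))) ⟨
    1# * (1# * f (v ◂ v ◂ R) + 1# * f (v ◂ w ◂ R)) + 1# * (1# * f (w ◂ v ◂ R) + 1# * f (w ◂ w ◂ R))
      ≈⟨ +-cong (*-congˡ (second v)) (*-congˡ (second w)) ⟨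
    1# * f (v ◂ v+w ◂ R) + 1# * f (w ◂ v+w ◂ R)
      ≈⟨ head-linear F 1# 1# (v+w ◂ R) split ⟨
    f (v+w ◂ v+w ◂ R)
      ≈⟨ diag v+w ⟩
    0#  ∎
    where
    open IsAlternating F
    v+w : Vector Carrier _
    v+w b = v b + w b
    split : ∀ b → v+w b ≈ 1# * v b + 1# * w b
    split b = sym (+-cong (*-identityˡ _) (*-identityˡ _))
    diag : ∀ u → f (u ◂ u ◂ R) ≈ 0#
    diag u = alt {zero} {suc zero} (λ ()) (λ _ → refl)
    second : ∀ u → f (u ◂ v+w ◂ R) ≈ 1# * f (u ◂ v ◂ R) + 1# * f (u ◂ w ◂ R)
    second u = head-linear (◂-alternating F u) 1# 1# R split

  sign-square : ∀ {n} (j : Fin n) → sign j * sign j ≈ 1#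
  sign-square zero    = *-identityˡ 1#
  sign-square (suc j) = trans
    (solve 1 (λ s → ((:- con (+ 1)) :* s) :* ((:- con (+ 1)) :* s) := s :* s) refl (sign j))
    (sign-square j)

  -- Row `j` has to pass the `toℕ j` rows above it, at the cost of one sign each.
  move-to-front : ∀ {n N} {f : Rows (suc n) N → Carrier} → IsAlternating f →
                  ∀ M j → f (M j ◂ removeAt M j) ≈ sign j * f M
  move-to-front {f = f} F M zero = trans (sym (cong (◂-tail M))) (sym (*-identityˡ _))
    where open IsAlternating F
  move-to-front {suc n} {f = f} F M (suc j) = begin
    f (M (suc j) ◂ removeAt M (suc j))
      ≈⟨ cong (◂-cong (λ _ → refl) (◂-tail (removeAt M (suc j)))) ⟩
    f (M (suc j) ◂ M zero ◂ removeAt (tail M) j)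
      ≈⟨ swap-rows F (M (suc j)) (M zero) (removeAt (tail M) j) ⟩
    - f (M zero ◂ M (suc j) ◂ removeAt (tail M) j)
      ≈⟨ -‿cong (move-to-front (◂-alternating F (M zero)) (tail M) j) ⟩
    - (sign j * f (M zero ◂ tail M))
      ≈⟨ -‿cong (*-congˡ (cong (◂-tail M))) ⟨
    - (sign j * f M)
      ≈⟨ solve 2 (λ s x → :- (s :* x) := ((:- con (+ 1)) :* s) :* x) refl (sign j) (f M) ⟩
    sign (suc j) * f M  ∎
    where open IsAlternating F

  -- The Laplace expansion is alternating

  laplace-cong : ∀ {n} → (∀ {M M′ : Matrix n} → (∀ a → M a ≋ M′ a) → Det M ≈ Det M′) →
                 ∀ {v v′ : Vector Carrier (suc n)} {R R′} → v ≋ v′ → (∀ a → R a ≋ R′ a) →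
                 laplace v R ≈ laplace v′ R′
  laplace-cong det-cong v≋v′ R≋R′ = ∑-cong λ j →
    *-congˡ (*-cong (v≋v′ j) (det-cong λ a b → R≋R′ a (punchIn j b)))

  laplace-alternating : ∀ {n} → IsAlternating (Det {n}) → ∀ v → IsAlternating (laplace {n} v)
  laplace-alternating D v = record
    { cong   = laplace-cong cong (λ _ → refl)
    ; linear = λ i {M} {M′} {M″} x y eq′ eq″ eq → begin
        laplace v M
          ≈⟨ ∑-cong (λ j → *-congˡ (*-congˡ (linear i x y
               (λ a a≢i b → eq′ a a≢i (punchIn j b)) (λ a a≢i b → eq″ a a≢i (punchIn j b))
               (λ b → eq (punchIn j b))))) ⟩
        ∑ (λ j → sign j * (v j * (x * minor M′ j + y * minor M″ j)))
          ≈⟨ ∑-cong (λ j → solve 6 (λ s v x a y b → s :* (v :* (x :* a :+ y :* b)) :=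
                 x :* (s :* (v :* a)) :+ y :* (s :* (v :* b))) refl
                 (sign j) (v j) x (minor M′ j) y (minor M″ j)) ⟩
        ∑ (λ j → x * (sign j * (v j * minor M′ j)) + y * (sign j * (v j * minor M″ j)))
          ≈⟨ ∑-distrib-+ _ _ ⟩
        ∑ (λ j → x * (sign j * (v j * minor M′ j))) + ∑ (λ j → y * (sign j * (v j * minor M″ j)))
          ≈⟨ +-cong (*-distribˡ-∑ x _) (*-distribˡ-∑ y _) ⟨
        x * laplace v M′ + y * laplace v M″  ∎
    ; alt    = λ i≢j eq → ∑-0 λ j →
        trans (*-congˡ (trans (*-congˡ (alt i≢j (λ b → eq (punchIn j b)))) (zeroʳ _))) (zeroʳ _)
    }
    where
    open IsAlternating D
    minor : Rows _ (suc _) → Fin (suc _) → Carrier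
    minor M j = Det (λ a → removeAt (M a) j)

  -- D j l depends only on the unordered pair of columns {j, punchIn j l}.
  Paired : ∀ n → (Fin (suc n) → Fin n → Carrier) → Set ℓ₁
  Paired zero    D = ⊤
  Paired (suc n) D = (∀ l → D zero l ≈ D (suc l) zero) × Paired n (λ j l → D (suc j) (suc l))

  -- `punchIn j ∘ punchIn l` lists the columns other than `j` and `punchIn j l` in increasing order,
  -- whichever of the two was deleted first. The functional `E` replaces a concrete minor so that
  -- the induction can keep an additional first column by means of `lift 1`.
  paired : ∀ n (E : (Fin n → Fin (suc (suc n))) → Carrier) → (∀ {φ ψ} → φ ≗ ψ → E φ ≈ E ψ) →
           ∀ D → (∀ j l → D j l ≈ E (punchIn j ∘ punchIn l)) → Paired (suc n) D
  paired zero    E E-cong D eq = (λ l → trans (eq zero l) (trans (E-cong λ ()) (sym (eq (suc l) zero)))) , tt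
  paired (suc n) E E-cong D eq =
    (λ l → trans (eq zero l) (sym (eq (suc l) zero))) ,
    paired n (E ∘ lift 1) (λ {φ} {ψ} φ≗ψ → E-cong λ { zero → ≡.refl ; (suc b) → ≡.cong suc (φ≗ψ b) }) _
      (λ j l → trans (eq (suc j) (suc l)) (E-cong λ { zero → ≡.refl ; (suc b) → ≡.refl }))

  -- This is the double expansion along two equal rows `v`: each pair of columns is chosen in both
  -- orders, with opposite signs. The induction sets column `zero` apart. The terms that choose it
  -- first cancel those that choose it second, and in the remaining terms the two signs caused by
  -- the shift of both indices compensate each other.
  paired-sum : ∀ n (v : Vector Carrier (suc n)) D → Paired n D →
               ∑ (λ j → sign j * (v j * ∑ (λ l → sign l * (v (punchIn j l) * D j l)))) ≈ 0#
  paired-sum zero    v D _         = ∑-0 λ j →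
    trans (*-congˡ (trans (*-congˡ (∑-zero _)) (zeroʳ _))) (zeroʳ _)
  paired-sum (suc n) v D (d₀ , d₊) = begin
    ∑ (λ j → sign j * (v j * ∑ (λ l → sign l * (v (punchIn j l) * D j l))))
      ≈⟨ trans (∑-suc _) (+-congˡ (∑-cong λ j → *-congˡ (*-congˡ (∑-suc _)))) ⟩
    1# * (v₀ * ∑ (λ l → sign l * (v (suc l) * D zero l))) +
      ∑ (λ j → sign (suc j) * (v (suc j) * (1# * (v₀ * D (suc j) zero) +
        ∑ (λ l → sign (suc l) * (v (suc (punchIn j l)) * D (suc j) (suc l))))))
      ≈⟨ +-cong first (∑-cong λ j → *-congˡ (*-congˡ (+-congˡ (inner j)))) ⟩
    ∑ X + ∑ (λ j → sign (suc j) * (v (suc j) * (1# * (v₀ * D (suc j) zero) + - Y j)))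
      ≈⟨ ∑-distrib-+ X _ ⟨
    ∑ (λ j → X j + sign (suc j) * (v (suc j) * (1# * (v₀ * D (suc j) zero) + - Y j)))
      ≈⟨ ∑-cong (λ j → solve 5 (λ s v₀ v₁ d y →
           s :* (v₀ :* (v₁ :* d)) :+ ((:- con (+ 1)) :* s) :* (v₁ :* (con (+ 1) :* (v₀ :* d) :+ :- y)) :=
           s :* (v₁ :* y)) refl (sign j) v₀ (v (suc j)) (D (suc j) zero) (Y j)) ⟩
    ∑ (λ j → sign j * (v (suc j) * Y j))
      ≈⟨ paired-sum n (v ∘ suc) (λ j l → D (suc j) (suc l)) d₊ ⟩
    0#  ∎
    where
    v₀ = v zero
    X Y : Vector Carrier (suc n)
    X j = sign j * (v₀ * (v (suc j) * D (suc j) zero))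
    Y j = ∑ (λ l → sign l * (v (suc (punchIn j l)) * D (suc j) (suc l)))
    first : 1# * (v₀ * ∑ (λ l → sign l * (v (suc l) * D zero l))) ≈ ∑ X
    first = trans (*-identityˡ _) (trans (*-distribˡ-∑ v₀ _) (∑-cong λ l →
      trans (*-congˡ (*-congˡ (*-congˡ (d₀ l))))
        (solve 4 (λ v₀ s v₁ d → v₀ :* (s :* (v₁ :* d)) := s :* (v₀ :* (v₁ :* d))) refl _ _ _ _)))
    inner : ∀ j → ∑ (λ l → sign (suc l) * (v (suc (punchIn j l)) * D (suc j) (suc l))) ≈ - Y j
    inner j = begin
      ∑ (λ l → sign (suc l) * (v (suc (punchIn j l)) * D (suc j) (suc l)))
        ≈⟨ ∑-cong (λ l → *-assoc (- 1#) (sign l) _) ⟩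
      ∑ (λ l → (- 1#) * (sign l * (v (suc (punchIn j l)) * D (suc j) (suc l))))
        ≈⟨ *-distribˡ-∑ (- 1#) (λ l → sign l * (v (suc (punchIn j l)) * D (suc j) (suc l))) ⟨
      (- 1#) * Y j
        ≈⟨ solve 1 (λ y → (:- con (+ 1)) :* y := :- y) refl (Y j) ⟩
      - Y j  ∎

  laplace-equal-heads : ∀ {n} → IsAlternating (Det {n}) → ∀ v (R : Rows n (suc (suc n))) →
                        laplace v (v ◂ R) ≈ 0#
  laplace-equal-heads {n} D v R = trans
    (∑-cong λ j → *-congˡ (*-congˡ (Det-suc (λ a → removeAt ((v ◂ R) a) j))))
    (paired-sum (suc n) v E
      (paired n (λ φ → Det (λ a → R a ∘ φ))
                (λ φ≗ψ → cong λ a b → reflexive (≡.cong (R a) (φ≗ψ b))) E (λ _ _ → refl)))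
    where
    open IsAlternating D
    E : Fin (suc (suc n)) → Fin (suc n) → Carrier
    E j l = Det λ a → R a ∘ punchIn j ∘ punchIn l

  -- Two equal rows below the first are dealt with by the minors. If the first row equals a lower
  -- one, that row is brought to second position and the double expansion vanishes.
  Det-alternating : ∀ n → IsAlternating (Det {n})
  Det-alternating zero = record
    { cong = λ _ → trans (Det-zero _) (sym (Det-zero _)) ; linear = λ () ; alt = λ {i} → λ { {()} } }
  Det-alternating (suc n) = record
    { cong   = λ eq → trans (Det-suc _) (trans (l-cong (eq zero) (eq ∘ suc)) (sym (Det-suc _)))
    ; linear = linear
    ; alt    = alt
    }
    where
    D = Det-alternating n
    module L v = IsAlternating (laplace-alternating D v)
    l-cong : ∀ {v v′ : Vector Carrier (suc n)} {R R′ : Rows n (suc n)} → v ≋ v′ → (∀ a → R a ≋ R′ a) →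
             laplace v R ≈ laplace v′ R′
    l-cong = laplace-cong (IsAlternating.cong D)

    linear : ∀ i {M M′ M″ : Matrix (suc n)} x y →
             (∀ a → a ≢ i → M a ≋ M′ a) → (∀ a → a ≢ i → M a ≋ M″ a) →
             (∀ b → M i b ≈ x * M′ i b + y * M″ i b) →
             Det M ≈ x * Det M′ + y * Det M″
    linear zero {M} {M′} {M″} x y eq′ eq″ eq = begin
      Det M
        ≈⟨ Det-suc M ⟩
      ∑ (λ j → sign j * (M zero j * minor j))
        ≈⟨ ∑-cong (λ j → *-congˡ (*-congʳ (eq j))) ⟩
      ∑ (λ j → sign j * ((x * M′ zero j + y * M″ zero j) * minor j))
        ≈⟨ ∑-cong (λ j → solve 6 (λ s d x a y b → s :* ((x :* a :+ y :* b) :* d) :=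
               x :* (s :* (a :* d)) :+ y :* (s :* (b :* d))) refl
               (sign j) (minor j) x (M′ zero j) y (M″ zero j)) ⟩
      ∑ (λ j → x * (sign j * (M′ zero j * minor j)) + y * (sign j * (M″ zero j * minor j)))
        ≈⟨ ∑-distrib-+ _ _ ⟩
      ∑ (λ j → x * (sign j * (M′ zero j * minor j))) + ∑ (λ j → y * (sign j * (M″ zero j * minor j)))
        ≈⟨ +-cong (*-distribˡ-∑ x _) (*-distribˡ-∑ y _) ⟨
      x * laplace (M′ zero) (tail M) + y * laplace (M″ zero) (tail M)
        ≈⟨ +-cong (*-congˡ (l-cong {R′ = tail M′} (λ _ → refl) λ a → eq′ (suc a) (λ ())))
                  (*-congˡ (l-cong {R′ = tail M″} (λ _ → refl) λ a → eq″ (suc a) (λ ()))) ⟩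
      x * laplace (M′ zero) (tail M′) + y * laplace (M″ zero) (tail M″)
        ≈⟨ +-cong (*-congˡ (Det-suc M′)) (*-congˡ (Det-suc M″)) ⟨
      x * Det M′ + y * Det M″  ∎
      where
      minor : Fin (suc n) → Carrier
      minor j = Det (λ a → removeAt (M (suc a)) j)
    linear (suc i) {M} {M′} {M″} x y eq′ eq″ eq = begin
      Det M
        ≈⟨ Det-suc M ⟩
      laplace (M zero) (tail M)
        ≈⟨ L.linear (M zero) i x y
             (λ a a≢i → eq′ (suc a) (a≢i ∘ suc-injective))
             (λ a a≢i → eq″ (suc a) (a≢i ∘ suc-injective)) eq ⟩
      x * laplace (M zero) (tail M′) + y * laplace (M zero) (tail M″)
        ≈⟨ +-cong (*-congˡ (l-cong {R = tail M′} (eq′ zero λ ()) λ _ _ → refl))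
                  (*-congˡ (l-cong {R = tail M″} (eq″ zero λ ()) λ _ _ → refl)) ⟩
      x * laplace (M′ zero) (tail M′) + y * laplace (M″ zero) (tail M″)
        ≈⟨ +-cong (*-congˡ (Det-suc M′)) (*-congˡ (Det-suc M″)) ⟨
      x * Det M′ + y * Det M″  ∎

    heads : ∀ v (R : Rows n (suc n)) j → v ≋ R j → laplace v R ≈ 0#
    heads = go n D
      where
      -- The size is abstracted so that it can be matched: a row `j` exists only if it is a
      -- successor, and then there is a second row to expand along.
      go : ∀ n → IsAlternating (Det {n}) → ∀ v (R : Rows n (suc n)) j → v ≋ R j → laplace v R ≈ 0#
      go (suc n) D v R j eq = begin
        laplace v R                        ≈⟨ *-identityˡ _ ⟨
        1# * laplace v R                   ≈⟨ *-congʳ (sign-square j) ⟨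
        -- Since `sign j` is its own inverse, one of the two copies pays for moving row `j` to the
        -- front.
        sign j * sign j * laplace v R      ≈⟨ *-assoc _ _ _ ⟩
        sign j * (sign j * laplace v R)    ≈⟨ *-congˡ (move-to-front (laplace-alternating D v) R j) ⟨
        sign j * laplace v (R j ◂ removeAt R j)
                                           ≈⟨ *-congˡ (laplace-cong (IsAlternating.cong D) (λ _ → refl)
                                                (◂-cong (λ b → sym (eq b)) λ _ _ → refl)) ⟩
        sign j * laplace v (v ◂ removeAt R j)
                                           ≈⟨ *-congˡ (laplace-equal-heads (Det-alternating _) v (removeAt R j)) ⟩
        sign j * 0#                        ≈⟨ zeroʳ _ ⟩
        0#                                 ∎

    alt : ∀ {i j} {M : Matrix (suc n)} → i ≢ j → M i ≋ M j → Det M ≈ 0#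
    alt {zero}  {zero}      i≢j eq = contradiction ≡.refl i≢j
    alt {zero}  {suc j} {M} i≢j eq = trans (Det-suc M) (heads (M zero) (tail M) j eq)
    alt {suc i} {zero}  {M} i≢j eq = trans (Det-suc M) (heads (M zero) (tail M) i (λ b → sym (eq b)))
    alt {suc i} {suc j} {M} i≢j eq = trans (Det-suc M) (L.alt (M zero) {i} {j} {tail M} (i≢j ∘ ≡.cong suc) eq)

  -- Uniqueness of alternating functions, with products and reindexing as consequences

  -- The first row is expanded in unit vectors. Under the unit vector `I j` column `j` may be
  -- cleared, and what is left is an alternating function of the minor, to which the induction
  -- hypothesis applies. The resulting sum is the Laplace expansion times `f I`.
  alternating-unique : ∀ n {f : Matrix n → Carrier} → IsAlternating f → ∀ M → f M ≈ Det M * f I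
  alternating-unique zero {f} F M = begin
    f M           ≈⟨ IsAlternating.cong F (λ ()) ⟩
    f I           ≈⟨ *-identityˡ _ ⟨
    1# * f I      ≈⟨ *-congʳ (Det-zero M) ⟨
    Det M * f I   ∎
  alternating-unique (suc n) {f} F M = begin
    f M
      ≈⟨ cong M≋ ⟩
    f ((λ b → ∑ λ j → M zero j * I j b) ◂ tail M)
      ≈⟨ head-sum F (M zero) I (tail M) ⟩
    ∑ (λ j → M zero j * f (I j ◂ tail M))
      ≈⟨ ∑-cong (λ j → *-congˡ (clear j)) ⟩
    ∑ (λ j → M zero j * f (I j ◂ insert j (minor j)))
      ≈⟨ ∑-cong (λ j → *-congˡ (trans (alternating-unique n (G j) (minor j)) (*-congˡ (g-I j)))) ⟩
    ∑ (λ j → M zero j * (Det (minor j) * (sign j * f I)))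
      ≈⟨ ∑-cong (λ j → solve 4 (λ m d s e → m :* (d :* (s :* e)) := (s :* (m :* d)) :* e) refl
           (M zero j) (Det (minor j)) (sign j) (f I)) ⟩
    ∑ (λ j → (sign j * (M zero j * Det (minor j))) * f I)
      ≈⟨ *-distribʳ-∑ (f I) _ ⟨
    laplace (M zero) (tail M) * f I
      ≈⟨ *-congʳ (Det-suc M) ⟨
    Det M * f I  ∎
    where
    open IsAlternating F
    minor : Fin (suc n) → Matrix n
    minor j a = removeAt (M (suc a)) j
    insert : Fin (suc n) → Matrix n → Rows n (suc n)
    insert j R a = insertAt (R a) j 0#

    M≋ : ∀ a → M a ≋ ((λ b → ∑ λ j → M zero j * I j b) ◂ tail M) a
    M≋ zero    b = sym (∑-Iʳ b (M zero))
    M≋ (suc a) b = refl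

    insert-at : ∀ j R a → insert j R a j ≈ 0#
    insert-at j R a = reflexive (insertAt-lookup (R a) j 0#)
    insert-off : ∀ j R a b → insert j R a (punchIn j b) ≈ R a b
    insert-off j R a b = reflexive (insertAt-punchIn (R a) j 0# b)

    -- The first row being the j-th unit vector, column j can be cleared below it.
    clear : ∀ j → f (I j ◂ tail M) ≈ f (I j ◂ insert j (minor j))
    clear j = rowwise (λ R → f (I j ◂ R)) (IsAlternating.cong (◂-alternating F (I j)))
      (λ v w → ∀ b → v (punchIn j b) ≈ w (punchIn j b))
      (λ i {R} {R′} off eq → add-row F {suc i} {zero} {I j ◂ R} {I j ◂ R′} (R i j - R′ i j) (λ ())
        (λ { zero _ b → refl ; (suc a) a≢ → off a (a≢ ∘ ≡.cong suc) })
        (punchIn-elim j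
          (trans (solve 2 (λ r r′ → r := r′ :+ (r :- r′) :* con (+ 1)) refl (R i j) (R′ i j))
                 (+-congˡ (*-congˡ (sym (I-diag j)))))
          (λ b → trans (eq b)
            (trans (solve 2 (λ r′ d → r′ := r′ :+ d :* con (+ 0)) refl (R′ i (punchIn j b)) (R i j - R′ i j))
              (+-congˡ (*-congˡ (sym (I-off (λ e → punchInᵢ≢i j b (≡.sym e))))))))))
      (λ a b → sym (insert-off j (minor j) a b))

    G : ∀ j → IsAlternating (λ R → f (I j ◂ insert j R))
    G j = record
      { cong   = λ {R} {R′} eq → F′.cong λ a → insert-cong R R′ a (eq a)
      ; linear = λ i {R} {R′} {R″} x y off′ off″ eq → F′.linear i x y
          (λ a a≢i → insert-cong R R′ a (off′ a a≢i)) (λ a a≢i → insert-cong R R″ a (off″ a a≢i))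
          (punchIn-elim j
            (trans (insert-at j R i) (trans (solve 2 (λ x y → con (+ 0) := x :* con (+ 0) :+ y :* con (+ 0)) refl x y)
              (sym (+-cong (*-congˡ (insert-at j R′ i)) (*-congˡ (insert-at j R″ i))))))
            (λ b → trans (insert-off j R i b) (trans (eq b)
              (sym (+-cong (*-congˡ (insert-off j R′ i b)) (*-congˡ (insert-off j R″ i b)))))))
      ; alt    = λ {i} {i′} {R} i≢i′ eq → F′.alt i≢i′ (punchIn-elim j
          (trans (insert-at j R i) (sym (insert-at j R i′)))
          (λ b → trans (insert-off j R i b) (trans (eq b) (sym (insert-off j R i′ b)))))
      }
      where
      module F′ = IsAlternating (◂-alternating F (I j))
      insert-cong : ∀ (R R′ : Matrix n) a → R a ≋ R′ a → insert j R a ≋ insert j R′ a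
      insert-cong R R′ a eq = punchIn-elim j
        (trans (insert-at j R a) (sym (insert-at j R′ a)))
        (λ b → trans (insert-off j R a b) (trans (eq b) (sym (insert-off j R′ a b))))

    -- The argument on the left is the identity matrix with row `j` moved to the front, which is the
    -- origin of the signs in the Laplace expansion.
    g-I : ∀ j → f (I j ◂ insert j I) ≈ sign j * f I
    g-I j = trans (cong (◂-cong (λ _ → refl) insert-I)) (move-to-front F I j)
      where
      insert-I : ∀ a → insert j I a ≋ I (punchIn j a)
      insert-I a = punchIn-elim j
        (trans (insert-at j I a) (sym (I-off (punchInᵢ≢i j a))))
        (λ b → trans (insert-off j I a b) (sym (I-injective (punchIn j) (punchIn-injective j _ _) a b)))

  Det-cong : ∀ {n} {M M′ : Matrix n} → (∀ a b → M a b ≈ M′ a b) → Det M ≈ Det M′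
  Det-cong = IsAlternating.cong (Det-alternating _)

  Det-one : ∀ (M : Matrix 1) → Det M ≈ M zero zero
  Det-one M = begin
    Det M
      ≈⟨ trans (Det-suc M) (∑-suc _) ⟩
    _
      ≈⟨ +-cong (*-congˡ (*-congˡ (Det-zero _))) (∑-zero _) ⟩
    1# * (M zero zero * 1#) + 0#
      ≈⟨ solve 1 (λ m → con (+ 1) :* (m :* con (+ 1)) :+ con (+ 0) := m) refl (M zero zero) ⟩
    M zero zero  ∎

  infixl 7 _⊛_
  _⊛_ : ∀ {n} → Matrix n → Matrix n → Matrix n
  (M ⊛ N) a b = ∑ λ i → M a i * N i b

  -- For fixed `N` the left side is alternating in the rows of `M`, with value `Det N` at `I`.
  Det-⊛ : ∀ {n} (M N : Matrix n) → Det (M ⊛ N) ≈ Det M * Det N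
  Det-⊛ {n} M N = trans (alternating-unique n F M) (*-congˡ (Det-cong λ a b → ∑-Iˡ a (λ i → N i b)))
    where
    module D = IsAlternating (Det-alternating n)
    F : IsAlternating (λ M → Det (M ⊛ N))
    F = record
      { cong   = λ eq → D.cong λ a b → ∑-cong λ i → *-congʳ (eq a i)
      ; linear = λ i {M} {M′} {M″} x y eq′ eq″ eq → D.linear i x y
          (λ a a≢i b → ∑-cong λ j → *-congʳ (eq′ a a≢i j))
          (λ a a≢i b → ∑-cong λ j → *-congʳ (eq″ a a≢i j))
          (λ b → begin
            ∑ (λ j → M i j * N j b)
              ≈⟨ ∑-cong (λ j → trans (*-congʳ (eq j))
                   (solve 5 (λ x p y q r → (x :* p :+ y :* q) :* r := x :* (p :* r) :+ y :* (q :* r)) refl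
                     x (M′ i j) y (M″ i j) (N j b))) ⟩
            ∑ (λ j → x * (M′ i j * N j b) + y * (M″ i j * N j b))
              ≈⟨ ∑-distrib-+ _ _ ⟩
            ∑ (λ j → x * (M′ i j * N j b)) + ∑ (λ j → y * (M″ i j * N j b))
              ≈⟨ +-cong (*-distribˡ-∑ x _) (*-distribˡ-∑ y _) ⟨
            x * (M′ ⊛ N) i b + y * (M″ ⊛ N) i b  ∎)
      ; alt    = λ i≢j eq → D.alt i≢j λ b → ∑-cong λ l → *-congʳ (eq l)
      }

  Det-scalar : ∀ n t → Det {n} (λ a b → t * I a b) ≈ t ^ n
  Det-scalar zero    t = Det-zero _
  Det-scalar (suc n) t = begin
    Det (λ a b → t * I a b)
      ≈⟨ trans (Det-suc _) (∑-suc _) ⟩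
    1# * (t * 1# * Det (λ a b → t * I {n} a b)) + ∑ (λ j → sign (suc j) * (t * 0# * _))
      ≈⟨ +-cong (*-congˡ (*-congˡ (Det-scalar n t)))
           (∑-0 λ j → trans (*-congˡ (trans (*-congʳ (zeroʳ t)) (zeroˡ _))) (zeroʳ _)) ⟩
    1# * (t * 1# * t ^ n) + 0#
      ≈⟨ solve 2 (λ t e → con (+ 1) :* (t :* con (+ 1) :* e) :+ con (+ 0) := t :* e) refl t (t ^ n) ⟩
    t ^ suc n  ∎

  1^n≈1 : ∀ n → 1# ^ n ≈ 1#
  1^n≈1 zero    = refl
  1^n≈1 (suc n) = trans (*-identityˡ _) (1^n≈1 n)

  Det-I : ∀ n → Det {n} I ≈ 1#
  Det-I n = trans (Det-cong λ a b → sym (*-identityˡ _)) (trans (Det-scalar n 1#) (1^n≈1 n))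

  -- The left side is alternating in the rows of `M` with value `1#` at `I`, so signs of
  -- permutations never enter. Two sizes are allowed because `n + q` and `q + n` are not
  -- definitionally equal.
  Det-reindex : ∀ {m n} (π : Fin m → Fin n) (π⁻¹ : Fin n → Fin m) →
                (∀ a → π (π⁻¹ a) ≡ a) → (∀ a → π⁻¹ (π a) ≡ a) →
                ∀ M → Det (λ a b → M (π a) (π b)) ≈ Det M
  Det-reindex {m} {n} π π⁻¹ ππ⁻¹ π⁻¹π M = begin
    Det (λ a b → M (π a) (π b))          ≈⟨ alternating-unique n F M ⟩
    Det M * Det (λ a b → I (π a) (π b))  ≈⟨ *-congˡ (trans (Det-cong (I-injective π π-inj)) (Det-I m)) ⟩
    Det M * 1#                           ≈⟨ *-identityʳ _ ⟩
    Det M                                ∎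
    where
    π-inj : ∀ {a b} → π a ≡ π b → a ≡ b
    π-inj {a} {b} eq = ≡.trans (≡.sym (π⁻¹π a)) (≡.trans (≡.cong π⁻¹ eq) (π⁻¹π b))
    π⁻¹-inj : ∀ {a b} → π⁻¹ a ≡ π⁻¹ b → a ≡ b
    π⁻¹-inj {a} {b} eq = ≡.trans (≡.sym (ππ⁻¹ a)) (≡.trans (≡.cong π eq) (ππ⁻¹ b))
    adj : ∀ {a i} → a ≢ π⁻¹ i → π a ≢ i
    adj {a} a≢ eq = a≢ (≡.trans (≡.sym (π⁻¹π a)) (≡.cong π⁻¹ eq))
    module D = IsAlternating (Det-alternating m)
    F : IsAlternating (λ M → Det (λ a b → M (π a) (π b)))
    F = record
      { cong   = λ eq → D.cong λ a b → eq (π a) (π b)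
      ; linear = λ i {M} {M′} {M″} x y eq′ eq″ eq → D.linear (π⁻¹ i) x y
          (λ a a≢ b → eq′ (π a) (adj a≢) (π b))
          (λ a a≢ b → eq″ (π a) (adj a≢) (π b))
          (λ b → ≡.subst (λ i → M i (π b) ≈ x * M′ i (π b) + y * M″ i (π b)) (≡.sym (ππ⁻¹ i)) (eq (π b)))
      ; alt    = λ {i} {j} {M} i≢j eq → D.alt (i≢j ∘ π⁻¹-inj)
          (λ b → ≡.subst₂ (λ i j → M i (π b) ≈ M j (π b)) (≡.sym (ππ⁻¹ i)) (≡.sym (ππ⁻¹ j)) (eq (π b)))
      }

  -- Determinants of block triangular matrices

  -- In the expansion along the first row the terms of the second block vanish, and each remaining
  -- minor is again lower triangular with the same last block.
  Det-lowerBlock : ∀ n q (M : Matrix (n ℕ.+ q)) → (∀ a b → M (a ↑ˡ q) (n ↑ʳ b) ≈ 0#) →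
                   Det M ≈ Det (λ a b → M (a ↑ˡ q) (b ↑ˡ q)) * Det (λ a b → M (n ↑ʳ a) (n ↑ʳ b))
  Det-lowerBlock zero    q M _  = sym (trans (*-congʳ (Det-zero _)) (*-identityˡ _))
  Det-lowerBlock (suc n) q M M₀ = begin
    Det M
      ≈⟨ Det-suc M ⟩
    laplace (M zero) (tail M)
      ≈⟨ ∑-++ (suc n) q _ ⟩
    ∑ (λ j → sign (j ↑ˡ q) * (M zero (j ↑ˡ q) * Det (λ a → removeAt (M (suc a)) (j ↑ˡ q)))) +
      ∑ (λ i → sign (suc n ↑ʳ i) * (M zero (suc n ↑ʳ i) * Det (λ a → removeAt (M (suc a)) (suc n ↑ʳ i))))
      ≈⟨ +-cong
           (∑-cong λ j → *-cong (reflexive (≡.cong ((- 1#) ^_) (toℕ-↑ˡ j q)))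
             (*-congˡ (trans (Det-lowerBlock n q _ (λ a b →
                 trans (reflexive (≡.cong (M (suc (a ↑ˡ q))) (punchIn-↑ˡ-↑ʳ q j b))) (M₀ (suc a) b)))
               (*-cong (Det-cong λ a b → reflexive (≡.cong (M (suc (a ↑ˡ q))) (punchIn-↑ˡ-↑ˡ q j b)))
                       (Det-cong λ a b → reflexive (≡.cong (M (suc (n ↑ʳ a))) (punchIn-↑ˡ-↑ʳ q j b)))))))
           (∑-0 λ i → trans (*-congˡ (trans (*-congʳ (M₀ zero i)) (zeroˡ _))) (zeroʳ _)) ⟩
    ∑ (λ j → sign j * (A zero j * (Det (λ a → removeAt (A (suc a)) j) * Det B))) + 0#
      ≈⟨ trans (+-identityʳ _) (∑-cong λ j →
           solve 4 (λ s m d e → s :* (m :* (d :* e)) := (s :* (m :* d)) :* e) refl _ _ _ _) ⟩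
    ∑ (λ j → (sign j * (A zero j * Det (λ a → removeAt (A (suc a)) j))) * Det B)
      ≈⟨ *-distribʳ-∑ (Det B) _ ⟨
    laplace (A zero) (tail A) * Det B
      ≈⟨ *-congʳ (Det-suc A) ⟨
    Det A * Det B  ∎
    where
    A : Matrix (suc n)
    A a b = M (a ↑ˡ q) (b ↑ˡ q)
    B : Matrix q
    B a b = M (suc n ↑ʳ a) (suc n ↑ʳ b)

  exchange : ∀ n q → Fin (n ℕ.+ q) → Fin (q ℕ.+ n)
  exchange n q = join q n ∘ swap⊎ ∘ splitAt n

  exchange-↑ˡ : ∀ n q a → exchange n q (a ↑ˡ q) ≡ q ↑ʳ a
  exchange-↑ˡ n q a = ≡.cong (join q n ∘ swap⊎) (splitAt-↑ˡ n a q)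

  exchange-↑ʳ : ∀ n q a → exchange n q (n ↑ʳ a) ≡ a ↑ˡ n
  exchange-↑ʳ n q a = ≡.cong (join q n ∘ swap⊎) (splitAt-↑ʳ n q a)

  exchange-involutive : ∀ n q a → exchange n q (exchange q n a) ≡ a
  exchange-involutive n q a = ≡.trans
    (≡.cong (join q n ∘ swap⊎) (splitAt-join n q (swap⊎ (splitAt q a))))
    (≡.trans (≡.cong (join q n) (swap-involutive (splitAt q a))) (join-splitAt q n a))

  Det-exchange : ∀ n q (M : Matrix (q ℕ.+ n)) →
                 Det (λ a b → M (exchange n q a) (exchange n q b)) ≈ Det M
  Det-exchange n q = Det-reindex (exchange n q) (exchange q n) (exchange-involutive n q) (exchange-involutive q n)

  -- The determinant is expanded along rows only; exchanging the two blocks takes the place of a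
  -- transposition.
  Det-upperBlock : ∀ n q (M : Matrix (n ℕ.+ q)) → (∀ a b → M (n ↑ʳ a) (b ↑ˡ q) ≈ 0#) →
                   Det M ≈ Det (λ a b → M (a ↑ˡ q) (b ↑ˡ q)) * Det (λ a b → M (n ↑ʳ a) (n ↑ʳ b))
  Det-upperBlock n q M M₀ = begin
    Det M
      ≈⟨ Det-exchange q n M ⟨
    Det M′
      ≈⟨ Det-lowerBlock q n M′ (λ a b → trans (at (exchange-↑ˡ q n a) (exchange-↑ʳ q n b)) (M₀ a b)) ⟩
    Det (λ a b → M′ (a ↑ˡ n) (b ↑ˡ n)) * Det (λ a b → M′ (q ↑ʳ a) (q ↑ʳ b))
      ≈⟨ *-cong (Det-cong λ a b → at (exchange-↑ˡ q n a) (exchange-↑ˡ q n b))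
                (Det-cong λ a b → at (exchange-↑ʳ q n a) (exchange-↑ʳ q n b)) ⟩
    Det (λ a b → M (n ↑ʳ a) (n ↑ʳ b)) * Det (λ a b → M (a ↑ˡ q) (b ↑ˡ q))
      ≈⟨ *-comm _ _ ⟩
    Det (λ a b → M (a ↑ˡ q) (b ↑ˡ q)) * Det (λ a b → M (n ↑ʳ a) (n ↑ʳ b))  ∎
    where
    M′ : Matrix (q ℕ.+ n)
    M′ a b = M (exchange q n a) (exchange q n b)
    at : ∀ {a a′ b b′} → a ≡ a′ → b ≡ b′ → M a b ≈ M a′ b′
    at p q = reflexive (≡.cong₂ M p q)

  -- Schur complements and Sylvester's identity

  block : ∀ {n q} → Matrix n → (Fin n → Fin q → Carrier) → (Fin q → Fin n → Carrier) → Matrix q →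
          Matrix (n ℕ.+ q)
  block {n} A U V B a b =
    [ (λ a → [ A a , U a ]′ (splitAt n b)) , (λ a → [ V a , B a ]′ (splitAt n b)) ]′ (splitAt n a)

  module _ {n q} (A : Matrix n) (U : Fin n → Fin q → Carrier) (V : Fin q → Fin n → Carrier) (B : Matrix q) where
    block-ˡˡ : ∀ a b → block A U V B (a ↑ˡ q) (b ↑ˡ q) ≈ A a b
    block-ˡˡ a b rewrite splitAt-↑ˡ n a q | splitAt-↑ˡ n b q = refl
    block-ˡʳ : ∀ a b → block A U V B (a ↑ˡ q) (n ↑ʳ b) ≈ U a b
    block-ˡʳ a b rewrite splitAt-↑ˡ n a q | splitAt-↑ʳ n q b = refl
    block-ʳˡ : ∀ a b → block A U V B (n ↑ʳ a) (b ↑ˡ q) ≈ V a b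
    block-ʳˡ a b rewrite splitAt-↑ʳ n q a | splitAt-↑ˡ n b q = refl
    block-ʳʳ : ∀ a b → block A U V B (n ↑ʳ a) (n ↑ʳ b) ≈ B a b
    block-ʳʳ a b rewrite splitAt-↑ʳ n q a | splitAt-↑ʳ n q b = refl

  -- Multiply on the right by the block matrix with rows (y I, 0) and (V, I); the hypothesis B V = y V
  -- makes the product block upper triangular.
  schur : ∀ n q (M : Matrix (n ℕ.+ q)) {A : Matrix n} {U : Fin n → Fin q → Carrier}
          {V : Fin q → Fin n → Carrier} {B : Matrix q} (y : Carrier) →
          (∀ a b → M (a ↑ˡ q) (b ↑ˡ q) ≈ A a b) → (∀ a j → M (a ↑ˡ q) (n ↑ʳ j) ≈ - U a j) →
          (∀ i b → M (n ↑ʳ i) (b ↑ˡ q) ≈ - V i b) → (∀ i j → M (n ↑ʳ i) (n ↑ʳ j) ≈ B i j) →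
          (∀ i b → ∑ (λ j → B i j * V j b) ≈ y * V i b) →
          y ^ n * Det M ≈ Det (λ a b → y * A a b - ∑ (λ j → U a j * V j b)) * Det B
  schur n q M {A} {U} {V} {B} y M≈A M≈U M≈V M≈B BV≈yV = begin
    y ^ n * Det M
      ≈⟨ *-comm _ _ ⟩
    Det M * y ^ n
      ≈⟨ *-congˡ Det-L ⟨
    Det M * Det L
      ≈⟨ Det-⊛ M L ⟨
    Det (M ⊛ L)
      ≈⟨ Det-upperBlock n q (M ⊛ L) ML-ʳˡ ⟩
    Det (λ a b → (M ⊛ L) (a ↑ˡ q) (b ↑ˡ q)) * Det (λ i j → (M ⊛ L) (n ↑ʳ i) (n ↑ʳ j))
      ≈⟨ *-cong (Det-cong ML-ˡˡ) (Det-cong ML-ʳʳ) ⟩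
    Det (λ a b → y * A a b - ∑ (λ j → U a j * V j b)) * Det B  ∎
    where
    Y : Matrix n
    Y a b = y * I a b
    O : Fin n → Fin q → Carrier
    O _ _ = 0#
    L : Matrix (n ℕ.+ q)
    L = block Y O V I

    Det-L : Det L ≈ y ^ n
    Det-L = begin
      Det L                 ≈⟨ Det-lowerBlock n q L (block-ˡʳ Y O V I) ⟩
      _                     ≈⟨ *-cong (Det-cong (block-ˡˡ Y O V I)) (Det-cong (block-ʳʳ Y O V I)) ⟩
      Det Y * Det {q} I     ≈⟨ *-cong (Det-scalar n y) (Det-I q) ⟩
      y ^ n * 1#            ≈⟨ *-identityʳ _ ⟩
      y ^ n                 ∎

    ∑-scale : ∀ (f : Vector Carrier n) b → ∑ (λ a → f a * (y * I a b)) ≈ y * f b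
    ∑-scale f b = begin
      ∑ (λ a → f a * (y * I a b))  ≈⟨ ∑-cong (λ a → solve 3 (λ f y i → f :* (y :* i) := y :* (f :* i)) refl (f a) y (I a b)) ⟩
      ∑ (λ a → y * (f a * I a b))  ≈⟨ *-distribˡ-∑ y _ ⟨
      y * ∑ (λ a → f a * I a b)    ≈⟨ *-congˡ (∑-Iʳ b f) ⟩
      y * f b                      ∎

    ML-ˡˡ : ∀ a b → (M ⊛ L) (a ↑ˡ q) (b ↑ˡ q) ≈ y * A a b - ∑ (λ j → U a j * V j b)
    ML-ˡˡ a b = begin
      _ ≈⟨ ∑-++ n q _ ⟩
      _ ≈⟨ +-cong (∑-cong λ i → *-cong (M≈A a i) (block-ˡˡ Y O V I i b))
                  (∑-cong λ j → *-cong (M≈U a j) (block-ʳˡ Y O V I j b)) ⟩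
      ∑ (λ i → A a i * (y * I i b)) + ∑ (λ j → - U a j * V j b)
        ≈⟨ +-cong (∑-scale (A a) b) (trans (∑-cong λ j →
             solve 2 (λ u v → (:- u) :* v := :- (u :* v)) refl (U a j) (V j b)) (∑-neg _)) ⟩
      y * A a b - ∑ (λ j → U a j * V j b)  ∎

    ML-ʳˡ : ∀ i b → (M ⊛ L) (n ↑ʳ i) (b ↑ˡ q) ≈ 0#
    ML-ʳˡ i b = begin
      _ ≈⟨ ∑-++ n q _ ⟩
      _ ≈⟨ +-cong (∑-cong λ a → *-cong (M≈V i a) (block-ˡˡ Y O V I a b))
                  (∑-cong λ j → *-cong (M≈B i j) (block-ʳˡ Y O V I j b)) ⟩
      ∑ (λ a → - V i a * (y * I a b)) + ∑ (λ j → B i j * V j b)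
        ≈⟨ +-cong (∑-scale (λ a → - V i a) b) (BV≈yV i b) ⟩
      y * - V i b + y * V i b
        ≈⟨ solve 2 (λ y v → y :* (:- v) :+ y :* v := con (+ 0)) refl y (V i b) ⟩
      0#  ∎

    ML-ʳʳ : ∀ i j → (M ⊛ L) (n ↑ʳ i) (n ↑ʳ j) ≈ B i j
    ML-ʳʳ i j = begin
      _ ≈⟨ ∑-++ n q _ ⟩
      _ ≈⟨ +-cong (∑-0 λ a → trans (*-congˡ (block-ˡʳ Y O V I a j)) (zeroʳ _))
                  (∑-cong λ l → *-cong (M≈B i l) (block-ʳʳ Y O V I l j)) ⟩
      0# + ∑ (λ l → B i l * I l j)
        ≈⟨ trans (+-identityˡ _) (∑-Iʳ j (B i)) ⟩
      B i j  ∎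

  -- Both sides compute `t^r` times the determinant of the block matrix with rows `(t I, -U)` and
  -- `(-V, I)`: the left by the Schur complement at `I`, the right by the one at `t I`. The second
  -- complement is scaled by `t` instead of divided, so `t = 0` is allowed.
  sylvester : ∀ n r t (U : Fin n → Fin r → Carrier) (V : Fin r → Fin n → Carrier) →
              t ^ r * Det (λ a b → t * I a b - ∑ (λ i → U a i * V i b)) ≈
              t ^ n * Det (λ i j → t * I i j - ∑ (λ a → V i a * U a j))
  sylvester n r t U V = begin
    t ^ r * Det (λ a b → t * I a b - ∑ (λ i → U a i * V i b))
      ≈⟨ *-congˡ (trans (sym (*-identityʳ _)) (*-cong
           (Det-cong λ a b → +-congʳ (sym (*-identityˡ _))) (sym (Det-I r)))) ⟩
    t ^ r * (Det (λ a b → 1# * (t * I a b) - ∑ (λ i → U a i * V i b)) * Det {r} I)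
      ≈⟨ *-congˡ (schur n r M 1# (block-ˡˡ tI U⁻ V⁻ I) (block-ˡʳ tI U⁻ V⁻ I) (block-ʳˡ tI U⁻ V⁻ I)
           (block-ʳʳ tI U⁻ V⁻ I) (λ i b → trans (∑-Iˡ i (λ j → V j b)) (sym (*-identityˡ _)))) ⟨
    t ^ r * (1# ^ n * Det M)
      ≈⟨ *-congˡ (trans (*-congʳ (1^n≈1 n)) (*-identityˡ _)) ⟩
    t ^ r * Det M
      ≈⟨ *-congˡ (Det-exchange r n M) ⟨
    t ^ r * Det M′
      ≈⟨ schur r n M′ t
           (λ i j → trans (at (exchange-↑ˡ r n i) (exchange-↑ˡ r n j)) (block-ʳʳ tI U⁻ V⁻ I i j))
           (λ i b → trans (at (exchange-↑ˡ r n i) (exchange-↑ʳ r n b)) (block-ʳˡ tI U⁻ V⁻ I i b))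
           (λ a j → trans (at (exchange-↑ʳ r n a) (exchange-↑ˡ r n j)) (block-ˡʳ tI U⁻ V⁻ I a j))
           (λ a b → trans (at (exchange-↑ʳ r n a) (exchange-↑ʳ r n b)) (block-ˡˡ tI U⁻ V⁻ I a b))
           (λ a j → trans (trans (∑-cong λ b → *-assoc t _ _) (sym (*-distribˡ-∑ t _)))
                          (*-congˡ (∑-Iˡ a (λ b → U b j)))) ⟩
    Det (λ i j → t * I i j - ∑ (λ a → V i a * U a j)) * Det tI
      ≈⟨ trans (*-congˡ (Det-scalar n t)) (*-comm _ _) ⟩
    t ^ n * Det (λ i j → t * I i j - ∑ (λ a → V i a * U a j))  ∎
    where
    tI : Matrix n
    tI a b = t * I a b
    U⁻ : Fin n → Fin r → Carrier
    U⁻ a i = - U a i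
    V⁻ : Fin r → Fin n → Carrier
    V⁻ i a = - V i a
    M : Matrix (n ℕ.+ r)
    M = block tI U⁻ V⁻ I
    M′ : Matrix (r ℕ.+ n)
    M′ a b = M (exchange r n a) (exchange r n b)
    at : ∀ {a a′ b b′} → a ≡ a′ → b ≡ b′ → M a b ≈ M a′ b′
    at p q = reflexive (≡.cong₂ M p q)

  Det-blockDiagonal : ∀ k p (B : Matrix p) (M : Matrix (k ℕ.* p)) →
                      (∀ (i j : Fin k) (w x : Fin p) → M (combine i w) (combine j x) ≈ I i j * B w x) →
                      Det M ≈ Det B ^ k
  Det-blockDiagonal zero    p B M _  = Det-zero M
  Det-blockDiagonal (suc k) p B M eq = begin
    Det M
      ≈⟨ Det-lowerBlock p (k ℕ.* p) M offDiagonal ⟩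
    _
      ≈⟨ *-cong (Det-cong λ w x → trans (eq zero zero w x) (*-identityˡ _))
                (Det-blockDiagonal k p B _ (λ i j → eq (suc i) (suc j))) ⟩
    Det B ^ suc k  ∎
    where
    offDiagonal : ∀ w b → M (w ↑ˡ (k ℕ.* p)) (p ↑ʳ b) ≈ 0#
    offDiagonal w = combine-elim {k} {p} λ j x → trans (eq zero (suc j) w x) (zeroˡ _)

  -- Cancellation and order in the field

  open import Algebra.Properties.CommutativeSemiring.Exp commutativeSemiring public
    using (^-homo-*; ^-distrib-*; ^-congˡ)
  open IsDecTotalOrder isDecTotalOrder public using (total; antisym; ≤-respʳ-≈; ≤-respˡ-≈)
    renaming (trans to ≤-trans; refl to ≤-refl; reflexive to ≤-reflexive)

  *-cancelˡ-≉0 : ∀ {x y z} → x ≉ 0# → x * y ≈ x * z → y ≈ z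
  *-cancelˡ-≉0 {x} {y} {z} x≉0 eq with inverse x≉0
  ... | x⁻¹ , xx⁻¹≈1 = begin
    y               ≈⟨ *-identityˡ y ⟨
    1# * y          ≈⟨ *-congʳ xx⁻¹≈1 ⟨
    x * x⁻¹ * y     ≈⟨ solve 3 (λ x i y → x :* i :* y := i :* (x :* y)) refl x x⁻¹ y ⟩
    x⁻¹ * (x * y)   ≈⟨ *-congˡ eq ⟩
    x⁻¹ * (x * z)   ≈⟨ solve 3 (λ x i y → x :* i :* y := i :* (x :* y)) refl x x⁻¹ z ⟨
    x * x⁻¹ * z     ≈⟨ *-congʳ xx⁻¹≈1 ⟩
    1# * z          ≈⟨ *-identityˡ z ⟩
    z               ∎

  xy≈0⇒y≈0 : ∀ {x y} → x ≉ 0# → x * y ≈ 0# → y ≈ 0#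
  xy≈0⇒y≈0 {x} x≉0 eq = *-cancelˡ-≉0 x≉0 (trans eq (sym (zeroʳ x)))

  *-≉0 : ∀ {x y} → x ≉ 0# → y ≉ 0# → x * y ≉ 0#
  *-≉0 x≉0 y≉0 eq = y≉0 (xy≈0⇒y≈0 x≉0 eq)

  1≉0 : 1# ≉ 0#
  1≉0 eq = 0≉1 (sym eq)

  ^-≉0 : ∀ {x} n → x ≉ 0# → x ^ n ≉ 0#
  ^-≉0 zero    x≉0 = 1≉0
  ^-≉0 (suc n) x≉0 = *-≉0 x≉0 (^-≉0 n x≉0)

  x-y≉0 : ∀ {x y} → x ≉ y → x - y ≉ 0#
  x-y≉0 x≉y eq = x≉y (x∙y⁻¹≈ε⇒x≈y _ _ eq)

  +-nonNeg : ∀ {x y} → 0# ≤ x → 0# ≤ y → 0# ≤ x + y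
  +-nonNeg {x} {y} 0≤x 0≤y = ≤-trans 0≤y (≤-respˡ-≈ (+-identityˡ y) (+-mono-≤ y 0≤x))

  square-nonNeg : ∀ x → 0# ≤ x * x
  square-nonNeg x with total 0# x
  ... | inj₁ 0≤x = *-nonNeg 0≤x 0≤x
  ... | inj₂ x≤0 = ≤-respʳ-≈ (solve 1 (λ x → (:- x) :* (:- x) := x :* x) refl x) (*-nonNeg 0≤-x 0≤-x)
    where
    0≤-x : 0# ≤ - x
    0≤-x = ≤-respˡ-≈ (-‿inverseʳ x) (≤-respʳ-≈ (+-identityˡ (- x)) (+-mono-≤ (- x) x≤0))

  0≤1 : 0# ≤ 1#
  0≤1 = ≤-respʳ-≈ (*-identityˡ 1#) (square-nonNeg 1#)

  ⟦⟧-nonNeg : ∀ n → 0# ≤ ⟦ n ⟧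
  ⟦⟧-nonNeg zero    = ≤-refl
  ⟦⟧-nonNeg (suc n) = +-nonNeg 0≤1 (⟦⟧-nonNeg n)

  x+1≰x : ∀ {x} → ¬ (x + 1# ≤ x)
  x+1≰x {x} x+1≤x = 0≉1 (antisym 0≤1 (≤-respˡ-≈ eq₁ (≤-respʳ-≈ (-‿inverseʳ x) (+-mono-≤ (- x) x+1≤x))))
    where
    eq₁ : x + 1# - x ≈ 1#
    eq₁ = solve 1 (λ x → x :+ con (+ 1) :- x := con (+ 1)) refl x

  ⟦suc⟧≉0 : ∀ n → ⟦ suc n ⟧ ≉ 0#
  ⟦suc⟧≉0 n eq = x+1≰x (≤-respˡ-≈ (+-comm 1# ⟦ n ⟧) (≤-trans (≤-reflexive eq) (⟦⟧-nonNeg n)))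

  Avoids : List Carrier → Carrier → Set (c ⊔ ℓ₁)
  Avoids bs x = All (x ≉_) bs

  upperBound : ∀ bs → ∃ λ u → All (_≤ u) bs
  upperBound []       = 0# , []
  upperBound (b ∷ bs) with upperBound bs
  ... | u , bs≤u with total b u
  ...   | inj₁ b≤u = u , b≤u ∷ bs≤u
  ...   | inj₂ u≤b = b , ≤-refl ∷ All.map (λ b≤u → ≤-trans b≤u u≤b) bs≤u

  infinite : ∀ bs → ∃ (Avoids bs)
  infinite bs with upperBound bs
  ... | u , bs≤u = u + 1# , All.map (λ b≤u u+1≈b → x+1≰x (≤-respˡ-≈ (sym u+1≈b) b≤u)) bs≤u

  -- Polynomial functions

  -- Horner form with `n` coefficients. Leading coefficients may vanish, so the length only bounds
  -- the degree, and no coefficient ever has to be tested for being zero.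
  PolyOfLength : ℕ → (Carrier → Carrier) → Set (c ⊔ ℓ₁)
  PolyOfLength zero    f = ∀ x → f x ≈ 0#
  PolyOfLength (suc n) f = ∃₂ λ a g → PolyOfLength n g × (∀ x → f x ≈ a + x * g x)

  record IsPoly (f : Carrier → Carrier) : Set (c ⊔ ℓ₁) where
    constructor _,_
    field
      size   : ℕ
      ofSize : PolyOfLength size f

  open IsPoly

  poly-resp : ∀ n {f g} → (∀ x → f x ≈ g x) → PolyOfLength n f → PolyOfLength n g
  poly-resp zero    f≈g f≈0              = λ x → trans (sym (f≈g x)) (f≈0 x)
  poly-resp (suc n) f≈g (a , h , H , eq) = a , h , H , λ x → trans (sym (f≈g x)) (eq x)

  IsPoly-resp : ∀ {f g} → (∀ x → f x ≈ g x) → IsPoly f → IsPoly g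
  IsPoly-resp f≈g (n , F) = n , poly-resp n f≈g F

  poly-const : ∀ a → IsPoly (λ _ → a)
  poly-const a = 1 , a , (λ _ → 0#) , (λ _ → refl) ,
    λ x → solve 2 (λ a x → a := a :+ x :* con (+ 0)) refl a x

  poly-id : IsPoly (λ x → x)
  poly-id = 2 , 0# , (λ _ → 1#) , poly-const 1# .ofSize ,
    λ x → solve 1 (λ x → x := con (+ 0) :+ x :* con (+ 1)) refl x

  poly-+ : ∀ {f g} → IsPoly f → IsPoly g → IsPoly (λ x → f x + g x)
  poly-+ {f} {g} (zero , f≈0) G =
    IsPoly-resp (λ x → sym (trans (+-congʳ (f≈0 x)) (+-identityˡ _))) G
  poly-+ {f} {g} F@(suc _ , _) (zero , g≈0) =
    IsPoly-resp (λ x → sym (trans (+-congˡ (g≈0 x)) (+-identityʳ _))) F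
  poly-+ (suc m , a , f′ , F , f≈) (suc n , b , g′ , G , g≈) with poly-+ (m , F) (n , G)
  ... | l , H = suc l , a + b , _ , H , λ x → trans (+-cong (f≈ x) (g≈ x))
    (solve 5 (λ a b x f g → a :+ x :* f :+ (b :+ x :* g) := a :+ b :+ x :* (f :+ g)) refl a b x (f′ x) (g′ x))

  poly-scale : ∀ n a {f} → PolyOfLength n f → PolyOfLength n (λ x → a * f x)
  poly-scale zero    a f≈0             = λ x → trans (*-congˡ (f≈0 x)) (zeroʳ a)
  poly-scale (suc n) a (b , g , G , eq) = a * b , _ , poly-scale n a G , λ x →
    trans (*-congˡ (eq x)) (solve 4 (λ a b x g → a :* (b :+ x :* g) := a :* b :+ x :* (a :* g)) refl a b x (g x))

  poly-shift : ∀ {f} → IsPoly f → IsPoly (λ x → x * f x)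
  poly-shift (n , F) = suc n , 0# , _ , F , λ x → sym (+-identityˡ _)

  poly-* : ∀ {f g} → IsPoly f → IsPoly g → IsPoly (λ x → f x * g x)
  poly-* (zero  , f≈0) G = zero , λ x → trans (*-congʳ (f≈0 x)) (zeroˡ _)
  poly-* {f} {g} (suc m , a , f′ , F , f≈) G = IsPoly-resp
    (λ x → trans (solve 4 (λ a g x f → a :* g :+ x :* (f :* g) := (a :+ x :* f) :* g) refl a (g x) x (f′ x))
                 (*-congʳ (sym (f≈ x))))
    (poly-+ (G .size , poly-scale _ a (G .ofSize)) (poly-shift (poly-* (m , F) G)))

  poly-neg : ∀ {f} → IsPoly f → IsPoly (λ x → - f x)
  poly-neg {f} (n , F) = n ,
    poly-resp n (λ x → solve 1 (λ y → (:- con (+ 1)) :* y := :- y) refl (f x)) (poly-scale n (- 1#) F)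

  poly-minus : ∀ {f g} → IsPoly f → IsPoly g → IsPoly (λ x → f x - g x)
  poly-minus F G = poly-+ F (poly-neg G)

  poly-^ : ∀ {f} n → IsPoly f → IsPoly (λ x → f x ^ n)
  poly-^ zero    F = poly-const 1#
  poly-^ (suc n) F = poly-* F (poly-^ n F)

  poly-∑ : ∀ {n} {f : Fin n → Carrier → Carrier} → (∀ i → IsPoly (f i)) → IsPoly (λ x → ∑ λ i → f i x)
  poly-∑ {zero}  F = zero , λ x → ∑-zero _
  poly-∑ {suc n} F = IsPoly-resp (λ x → sym (∑-suc _)) (poly-+ (F zero) (poly-∑ (F ∘ suc)))

  poly-Det : ∀ {n} {M : Carrier → Matrix n} → (∀ a b → IsPoly (λ x → M x a b)) → IsPoly (λ x → Det (M x))
  poly-Det {zero}  F = IsPoly-resp (λ x → sym (Det-zero _)) (poly-const 1#)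
  poly-Det {suc n} F = IsPoly-resp (λ x → sym (Det-suc _))
    (poly-∑ λ j → poly-* (poly-const (sign j)) (poly-* (F zero j) (poly-Det λ a b → F (suc a) _)))

  -- Synthetic division by `x - a`. The quotient has one coefficient less, which drives the
  -- induction in `poly-vanish`.
  poly-divide : ∀ n {f} → PolyOfLength (suc n) f → ∀ a →
                ∃ λ q → PolyOfLength n q × (∀ x → f x ≈ f a + (x - a) * q x)
  poly-divide zero {f} (b , g , g≈0 , eq) a = g , g≈0 , λ x → begin
    f x                    ≈⟨ constant x ⟩
    b                      ≈⟨ constant a ⟨
    f a                    ≈⟨ solve 2 (λ y d → y := y :+ d :* con (+ 0)) refl (f a) (x - a) ⟩
    f a + (x - a) * 0#     ≈⟨ +-congˡ (*-congˡ (g≈0 x)) ⟨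
    f a + (x - a) * g x    ∎
    where
    constant : ∀ x → f x ≈ b
    constant x = trans (eq x) (trans (+-congˡ (trans (*-congˡ (g≈0 x)) (zeroʳ x))) (+-identityʳ b))
  poly-divide (suc n) {f} (b , g , G , eq) a with poly-divide n G a
  ... | r , R , g≈ = (λ x → g a + x * r x) , (g a , r , R , λ _ → refl) , λ x → begin
    f x                                       ≈⟨ trans (eq x) (+-congˡ (*-congˡ (g≈ x))) ⟩
    b + x * (g a + (x - a) * r x)             ≈⟨ solve 5 (λ b x e a r →
                                                   b :+ x :* (e :+ (x :- a) :* r) :=
                                                   b :+ a :* e :+ (x :- a) :* (e :+ x :* r)) refl b x (g a) a (r x) ⟩
    b + a * g a + (x - a) * (g a + x * r x)   ≈⟨ +-congʳ (eq a) ⟨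
    f a + (x - a) * (g a + x * r x)           ∎

  -- A point `a` outside `bs` is a root that can be divided out; the quotient vanishes off `a ∷ bs`
  -- and is shorter. The exceptional set may grow because the field is infinite.
  poly-vanish : ∀ n {f} → PolyOfLength n f → ∀ bs → (∀ x → Avoids bs x → f x ≈ 0#) → ∀ x → f x ≈ 0#
  poly-vanish zero    f≈0 bs _  = f≈0
  poly-vanish (suc n) {f} F bs off with infinite bs
  ... | a , a∉bs with poly-divide n F a
  ...   | q , Q , f≈ = λ x → trans (f≈′ x) (trans (*-congˡ (q≈0 x)) (zeroʳ _))
    where
    f≈′ : ∀ x → f x ≈ (x - a) * q x
    f≈′ x = trans (f≈ x) (trans (+-congʳ (off a a∉bs)) (+-identityˡ _))
    q≈0 : ∀ x → q x ≈ 0#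
    q≈0 = poly-vanish n Q (a ∷ bs) λ { x (x≉a ∷ x∉bs) →
      xy≈0⇒y≈0 (x-y≉0 x≉a) (trans (sym (f≈′ x)) (off x x∉bs)) }

  poly-ext : ∀ {f g} → IsPoly f → IsPoly g → ∀ bs → (∀ x → Avoids bs x → f x ≈ g x) → ∀ x → f x ≈ g x
  poly-ext {f} {g} F G bs off x = x∙y⁻¹≈ε⇒x≈y _ _
    (poly-vanish _ (poly-minus F G .ofSize) bs (λ x x∉bs → x≈y⇒x∙y⁻¹≈ε (off x x∉bs)) x)

  -- Products of linear factors and removal of roots

  fromRoots : List Carrier → Carrier → Carrier
  fromRoots λs x = foldr (λ μ y → (x - μ) * y) 1# λs

  fromRoots-++ : ∀ λs μs x → fromRoots (λs ++ μs) x ≈ fromRoots λs x * fromRoots μs x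
  fromRoots-++ []       μs x = sym (*-identityˡ _)
  fromRoots-++ (ν ∷ λs) μs x = trans (*-congˡ (fromRoots-++ λs μs x)) (sym (*-assoc _ _ _))

  fromRoots-replicate : ∀ k μ x → fromRoots (replicate k μ) x ≈ (x - μ) ^ k
  fromRoots-replicate zero    μ x = refl
  fromRoots-replicate (suc k) μ x = *-congˡ (fromRoots-replicate k μ x)

  fromRoots-concatMap : ∀ k λs x → fromRoots (concatMap (replicate k) λs) x ≈ fromRoots λs x ^ k
  fromRoots-concatMap k []       x = sym (1^n≈1 k)
  fromRoots-concatMap k (ν ∷ λs) x = begin
    fromRoots (replicate k ν ++ concatMap (replicate k) λs) x    ≈⟨ fromRoots-++ (replicate k ν) _ x ⟩
    _                                                            ≈⟨ *-cong (fromRoots-replicate k ν x) (fromRoots-concatMap k λs x) ⟩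
    (x - ν) ^ k * fromRoots λs x ^ k                             ≈⟨ ^-distrib-* (x - ν) (fromRoots λs x) k ⟨
    ((x - ν) * fromRoots λs x) ^ k                               ∎

  poly-fromRoots : ∀ λs → IsPoly (fromRoots λs)
  poly-fromRoots []       = poly-const 1#
  poly-fromRoots (ν ∷ λs) = poly-* (poly-minus poly-id (poly-const ν)) (poly-fromRoots λs)

  RootsOf⇒IsPoly : ∀ {f} λs → RootsOf f λs → IsPoly f
  RootsOf⇒IsPoly λs roots = IsPoly-resp (λ x → sym (roots x)) (poly-fromRoots λs)

  -- If `a` differs from the head `ν`, then `a - ν` is invertible and `a` must be a root of the
  -- tail; the empty product has no root. Without the hypothesis on `a`, `remove` might leave the
  -- list unchanged.
  fromRoots-remove : ∀ a λs → fromRoots λs a ≈ 0# →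
                     ∀ x → fromRoots λs x ≈ (x - a) * fromRoots (remove a λs) x
  fromRoots-remove a []       root x = contradiction root 1≉0
  fromRoots-remove a (ν ∷ λs) root x with a ≈? ν
  ... | yes a≈ν = *-congʳ (+-congˡ (-‿cong (sym a≈ν)))
  ... | no a≉ν  = begin
    (x - ν) * fromRoots λs x                             ≈⟨ *-congˡ (fromRoots-remove a λs (xy≈0⇒y≈0 (x-y≉0 a≉ν) root) x) ⟩
    (x - ν) * ((x - a) * fromRoots (remove a λs) x)      ≈⟨ solve 3 (λ u v w → u :* (v :* w) := v :* (u :* w)) refl _ _ _ ⟩
    (x - a) * ((x - ν) * fromRoots (remove a λs) x)      ∎

  -- Cancellation of `x - a` works only for `x` different from `a`; that `g` is polynomial supplies
  -- the missing point.
  RootsOf-remove : ∀ {f g} → IsPoly g → ∀ a λs → RootsOf f λs → (∀ x → f x ≈ (x - a) * g x) →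
                   RootsOf g (remove a λs)
  RootsOf-remove {f} {g} G a λs roots f≈ = poly-ext G (poly-fromRoots (remove a λs)) (a ∷ [])
    λ { x (x≉a ∷ []) → *-cancelˡ-≉0 (x-y≉0 x≉a)
          (trans (sym (f≈ x)) (trans (roots x) (fromRoots-remove a λs root x))) }
    where
    root : fromRoots λs a ≈ 0#
    root = trans (sym (roots a)) (trans (f≈ a) (trans (*-congʳ (-‿inverseʳ a)) (zeroˡ _)))

  -- The discriminant is `(A - B)² + 4 e`, a sum of nonnegative terms. Here `d` is its square root
  -- and `h` is one half.
  quadratic-splits : ∀ A B {e} → 0# ≤ e →
                     ∃₂ λ α₁ α₂ → RootsOf (λ x → (x - A) * (x - B) - e) (α₁ ∷ α₂ ∷ [])
  quadratic-splits A B {e} 0≤e with squareRoot (+-nonNeg (square-nonNeg (A - B)) (*-nonNeg (⟦⟧-nonNeg 4) 0≤e))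
                                  | inverse (⟦suc⟧≉0 1)
  ... | d , d²≈disc | h , 2h≈1 = (A + B + d) * h , (A + B - d) * h , λ x → begin
    (x - A) * (x - B) - e
      -- The factors `1#` are inserted in order to be replaced by `2 h`, since the solver does not
      -- know that `h` is one half.
      ≈⟨ solve 4 (λ x A B e → (x :- A) :* (x :- B) :- e :=
           x :* x :- (A :+ B) :* con (+ 1) :* x :+ (A :* B :- e) :* (con (+ 1) :* con (+ 1))) refl x A B e ⟩
    x * x - (A + B) * 1# * x + (A * B - e) * (1# * 1#)
      ≈⟨ +-cong (+-congˡ (-‿cong (*-congʳ (*-congˡ 2h≈1)))) (*-congˡ (*-cong 2h≈1 2h≈1)) ⟨
    x * x - (A + B) * (⟦ 2 ⟧ * h) * x + (A * B - e) * ((⟦ 2 ⟧ * h) * (⟦ 2 ⟧ * h))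
      -- The discriminant is made visible through `4 (A B - e) = (A + B)² - ((A - B)² + 4
      -- e)`, so that it can be exchanged for `d²`.
      ≈⟨ solve 5 (λ x A B e h → let one = con (+ 1) ; two = one :+ (one :+ con (+ 0)) in
           x :* x :- (A :+ B) :* (two :* h) :* x :+ (A :* B :- e) :* ((two :* h) :* (two :* h)) :=
           x :* x :- (A :+ B) :* (two :* h) :* x
             :+ ((A :+ B) :* (A :+ B) :- ((A :- B) :* (A :- B) :+ (one :+ (one :+ two)) :* e)) :* (h :* h))
           refl x A B e h ⟩
    x * x - (A + B) * (⟦ 2 ⟧ * h) * x + ((A + B) * (A + B) - ((A - B) * (A - B) + ⟦ 4 ⟧ * e)) * (h * h)
      ≈⟨ +-congˡ (*-congʳ (+-congˡ (-‿cong d²≈disc))) ⟨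
    x * x - (A + B) * (⟦ 2 ⟧ * h) * x + ((A + B) * (A + B) - d * d) * (h * h)
      ≈⟨ solve 5 (λ x A B d h → let one = con (+ 1) ; two = one :+ (one :+ con (+ 0)) in
           x :* x :- (A :+ B) :* (two :* h) :* x :+ ((A :+ B) :* (A :+ B) :- d :* d) :* (h :* h) :=
           (x :- (A :+ B :+ d) :* h) :* ((x :- (A :+ B :- d) :* h) :* one)) refl x A B d h ⟩
    (x - (A + B + d) * h) * ((x - (A + B - d) * h) * 1#)  ∎

  -- Indicators, adjacency matrices and degrees

  ind : ∀ {a} {A : Set a} → Dec A → Carrier
  ind d = if does d then 1# else 0#

  ind-⇔ : ∀ {a b} {A : Set a} {B : Set b} (d : Dec A) (d′ : Dec B) → (A → B) → (B → A) → ind d ≈ ind d′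
  ind-⇔ (yes _) (yes _) f g = refl
  ind-⇔ (no _)  (no _)  f g = refl
  ind-⇔ (yes a) (no ¬b) f g = contradiction (f a) ¬b
  ind-⇔ (no ¬a) (yes b) f g = contradiction (g b) ¬a

  ind-× : ∀ {a b} {A : Set a} {B : Set b} (d : Dec A) (d′ : Dec B) → ind (d ×-dec d′) ≈ ind d * ind d′
  ind-× (yes _) d′ = sym (*-identityˡ _)
  ind-× (no _)  d′ = sym (zeroˡ _)

  ind-yes : ∀ {a} {A : Set a} (d : Dec A) → A → ind d ≈ 1#
  ind-yes (yes _) a = refl
  ind-yes (no ¬a) a = contradiction a ¬a

  ind-no : ∀ {a} {A : Set a} (d : Dec A) → ¬ A → ind d ≈ 0#
  ind-no (yes a) ¬a = contradiction a ¬a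
  ind-no (no _)  ¬a = refl

  length-filter : ∀ {a} {A : Set a} {P : Pred A 0ℓ} (P? : Decidable P) n (f : Fin n → A) →
                  ⟦ length (filter P? (tabulate f)) ⟧ ≈ ∑ λ i → ind (P? (f i))
  length-filter P? zero    f = sym (∑-zero _)
  length-filter P? (suc n) f = trans split (sym (∑-suc _))
    where
    split : ⟦ length (filter P? (tabulate f)) ⟧ ≈ ind (P? (f zero)) + ∑ λ i → ind (P? (f (suc i)))
    split with does (P? (f zero))
    ... | true  = +-congˡ (length-filter P? n (f ∘ suc))
    ... | false = trans (length-filter P? n (f ∘ suc)) (sym (+-identityˡ _))

  ∑-nonNeg : ∀ {n} {f : Vector Carrier n} → (∀ i → 0# ≤ f i) → 0# ≤ ∑ f
  ∑-nonNeg {zero}  0≤f = ≤-reflexive (sym (∑-zero _))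
  ∑-nonNeg {suc n} 0≤f = ≤-respʳ-≈ (sym (∑-suc _)) (+-nonNeg (0≤f zero) (∑-nonNeg (0≤f ∘ suc)))

  ∑≈0⇒≈0 : ∀ {n} {f : Vector Carrier n} → (∀ i → 0# ≤ f i) → ∑ f ≈ 0# → ∀ i → f i ≈ 0#
  ∑≈0⇒≈0 {suc n} {f} 0≤f ∑f≈0 = λ { zero → f₀≈0 ; (suc i) → ∑≈0⇒≈0 (0≤f ∘ suc) tail≈0 i }
    where
    sum≈0 : f zero + ∑ (f ∘ suc) ≈ 0#
    sum≈0 = trans (sym (∑-suc f)) ∑f≈0
    f₀≤0 : f zero ≤ 0#
    f₀≤0 = ≤-respˡ-≈ (+-identityˡ _) (≤-respʳ-≈ (trans (+-comm _ _) sum≈0)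
             (+-mono-≤ (f zero) (∑-nonNeg (0≤f ∘ suc))))
    f₀≈0 : f zero ≈ 0#
    f₀≈0 = antisym f₀≤0 (0≤f zero)
    tail≈0 : ∑ (f ∘ suc) ≈ 0#
    tail≈0 = trans (sym (+-identityˡ _)) (trans (+-congʳ (sym f₀≈0)) sum≈0)

  ∑-I : ∀ {n} (i : Fin n) → ∑ (λ j → I i j) ≈ 1#
  ∑-I i = trans (∑-cong λ j → sym (*-identityʳ _)) (∑-Iˡ i λ _ → 1#)

  adj : ∀ {n} → Graph n → Matrix n
  adj X a b = ind (adj? X a b)

  adj-sym : ∀ {n} (X : Graph n) a b → adj X a b ≈ adj X b a
  adj-sym X a b = ind-⇔ (adj? X a b) (adj? X b a) (symm X) (symm X)

  degree-∑ : ∀ {n} (X : Graph n) a → ⟦ degree X a ⟧ ≈ ∑ (adj X a)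
  degree-∑ {n} X a = length-filter (adj? X a) n id

  -- Counting is done in the field: `missing` is nonnegative, it is `1#` exactly at the
  -- non-neighbours other than `a`, and its sum is `(n + 1) - 1 - n = 0`.
  full-degree : ∀ {n} (X : Graph (suc n)) {a} → degree X a ≡ n → ∀ {b} → a ≢ b → Adj X a b
  full-degree {n} X {a} deg {b} a≢b = from (adj? X a b) (missing≈0 b)
    where
    missing : Vector Carrier (suc n)
    missing b = (1# - I a b) - adj X a b
    missing-nonNeg : ∀ b → 0# ≤ missing b
    missing-nonNeg b with a ≟ b | adj? X a b
    ... | yes ≡.refl | yes aa = contradiction aa (irrefl X ≡.refl)
    ... | yes _      | no _   = ≤-reflexive (solve 0 (con (+ 0) := con (+ 1) :- con (+ 1) :- con (+ 0)) refl)
    ... | no _       | yes _  = ≤-reflexive (solve 0 (con (+ 0) := con (+ 1) :- con (+ 0) :- con (+ 1)) refl)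
    ... | no _       | no _   = ≤-respʳ-≈ (solve 0 (con (+ 1) := con (+ 1) :- con (+ 0) :- con (+ 0)) refl) 0≤1
    ∑missing≈0 : ∑ missing ≈ 0#
    ∑missing≈0 = begin
      ∑ missing
        ≈⟨ trans (∑-distrib-minus _ _) (+-congʳ (∑-distrib-minus _ _)) ⟩
      ∑ {suc n} (λ _ → 1#) - ∑ (I a) - ∑ (adj X a)
        ≈⟨ +-cong (+-cong (∑-1 (suc n)) (-‿cong (∑-I a)))
                  (-‿cong (trans (sym (degree-∑ X a)) (reflexive (≡.cong ⟦_⟧ deg)))) ⟩
      1# + ⟦ n ⟧ - 1# - ⟦ n ⟧
        ≈⟨ solve 1 (λ n → con (+ 1) :+ n :- con (+ 1) :- n := con (+ 0)) refl ⟦ n ⟧ ⟩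
      0#  ∎
    missing≈0 : ∀ b → missing b ≈ 0#
    missing≈0 = ∑≈0⇒≈0 missing-nonNeg ∑missing≈0
    from : (d : Dec (Adj X a b)) → (1# - I a b) - ind d ≈ 0# → Adj X a b
    from (yes ab) _  = ab
    from (no _)   eq = contradiction (trans (sym (trans (+-congʳ (+-congˡ (-‿cong (I-off a≢b))))
      (solve 0 (con (+ 1) :- con (+ 0) :- con (+ 0) := con (+ 1)) refl))) eq) 1≉0

-- The block of a single pocket

module PocketBlock {c ℓ₁ ℓ₂} (K : RealClosedField c ℓ₁ ℓ₂) {p r : ℕ}
  (P : EdgePocket p) (regular : IsRegular r (EdgePocket.H-uv P)) where

  open RealClosedField K
  open Spectra K
  open LinearAlgebra K
  open EdgePocket P
  open import Relation.Binary.Reasoning.Setoid setoid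

  y : Carrier → Carrier
  y x = x - (⟦ 2 ⟧ * ⟦ r ⟧ + ⟦ 2 ⟧)

  -- An inner vertex has degree `2 + r` in the pasted graph, the `2` counting the ends of its edge;
  -- by regularity this diagonal is a scalar.
  B₀ : Carrier → Matrix p
  B₀ x w w′ = (x - (⟦ 2 ⟧ + ⟦ r ⟧)) * I w w′ - adj H-uv w w′

  B₀-rowSum : ∀ x w → ∑ (B₀ x w) ≈ y x
  B₀-rowSum x w = begin
    ∑ (B₀ x w)
      ≈⟨ ∑-distrib-minus _ _ ⟩
    ∑ (λ w′ → (x - (⟦ 2 ⟧ + ⟦ r ⟧)) * I w w′) - ∑ (adj H-uv w)
      ≈⟨ +-cong (trans (sym (*-distribˡ-∑ _ _)) (*-congˡ (∑-I w)))
                (-‿cong (trans (sym (degree-∑ H-uv w)) (reflexive (≡.cong ⟦_⟧ (regular w))))) ⟩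
    (x - (⟦ 2 ⟧ + ⟦ r ⟧)) * 1# - ⟦ r ⟧
      ≈⟨ solve 2 (λ x r → let one = con (+ 1) ; two = one :+ (one :+ con (+ 0)) in
           (x :- (two :+ r)) :* one :- r := x :- (two :* r :+ two)) refl x ⟦ r ⟧ ⟩
    y x  ∎

-- Reduction of the determinant for the pasted graph to a scalar

module Pockets {c ℓ₁ ℓ₂} (K : RealClosedField c ℓ₁ ℓ₂) {n k p r : ℕ}
  (E : EdgeSet (complete n) k) (perfect : EdgeSet.IsPerfectMatching E) (P : EdgePocket p)
  (uH : ∀ w → Adj (EdgePocket.H P) (EdgePocket.u P) (EdgePocket.inner P w))
  (vH : ∀ w → Adj (EdgePocket.H P) (EdgePocket.v P) (EdgePocket.inner P w))
  (regular : IsRegular r (EdgePocket.H-uv P)) where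

  open RealClosedField K
  open Spectra K
  open LinearAlgebra K
  open EdgeSet E
  open EdgePocket P
  open Pasting (complete n) E P
  open Pocket P
  open Pasted (complete n) E
  open PocketBlock K P regular renaming (y to y[_]; B₀ to B[_]) using (B₀-rowSum)
  open import Relation.Binary.Reasoning.Setoid setoid

  edgeOf : Fin n → Fin k
  edgeOf a = proj₁ (perfect a)

  edgeOf-end : ∀ a → a IsEndOf edgeOf a
  edgeOf-end a = proj₁ (proj₂ (perfect a))

  edgeOf-unique : ∀ {a i} → a IsEndOf i → edgeOf a ≡ i
  edgeOf-unique {a} = proj₂ (proj₂ (perfect a))

  -- These are the column sums of the incidence matrix `W a i = I (edgeOf a) i`. Its columns have
  -- disjoint supports because a vertex has only one edge, so `Wᵀ W = 2 I`.
  two-ends : ∀ i → ∑ (λ a → I (edgeOf a) i) ≈ ⟦ 2 ⟧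
  two-ends i = begin
    ∑ (λ a → I (edgeOf a) i)                    ≈⟨ ∑-cong ends ⟩
    ∑ (λ a → I (src i) a + I (tgt i) a)         ≈⟨ ∑-distrib-+ _ _ ⟩
    ∑ (I (src i)) + ∑ (I (tgt i))               ≈⟨ +-cong (∑-I (src i)) (trans (∑-I (tgt i)) (sym (+-identityʳ _))) ⟩
    ⟦ 2 ⟧                                       ∎
    where
    ends : ∀ a → I (edgeOf a) i ≈ I (src i) a + I (tgt i) a
    ends a with edgeOf a ≟ i | edgeOf-end a
    ... | yes ≡.refl | inj₁ a≡src = sym (trans (+-cong
            (ind-yes (src (edgeOf a) ≟ a) (≡.sym a≡src))
            (I-off λ tgt≡a → edge _ (≡.sym (≡.trans tgt≡a a≡src)))) (+-identityʳ _))
    ... | yes ≡.refl | inj₂ a≡tgt = sym (trans (+-cong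
            (I-off λ src≡a → edge _ (≡.trans src≡a a≡tgt))
            (ind-yes (tgt (edgeOf a) ≟ a) (≡.sym a≡tgt))) (+-identityˡ _))
    ... | no e≢i     | _          = sym (trans (+-cong
            (I-off λ src≡a → e≢i (edgeOf-unique (inj₁ (≡.sym src≡a))))
            (I-off λ tgt≡a → e≢i (edgeOf-unique (inj₂ (≡.sym tgt≡a))))) (+-identityˡ _))

  adj-F-F : ∀ a b → adj G (fromF a) (fromF b) ≈ 1# - I a b
  adj-F-F a b with a ≟ b
  ... | yes ≡.refl = trans (ind-no (adj? G (fromF a) (fromF b)) (irrefl G ≡.refl)) (sym (-‿inverseʳ 1#))
  ... | no a≢b     = trans (ind-yes (adj? G (fromF a) (fromF b)) (inj₁ (a , b , ≡.refl , ≡.refl , a≢b)))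
                           (sym (trans (+-congˡ -0#≈0#) (+-identityʳ 1#)))

  -- That the value does not depend on `w` is the point: the coupling with a pocket is constant
  -- along it, and `B₀` acts on constants as the scalar `y`.
  adj-F-inner : ∀ a i w → adj G (fromF a) (fromInner i w) ≈ I (edgeOf a) i
  adj-F-inner a i w = ind-⇔ (adj? G (fromF a) (fromInner i w)) (edgeOf a ≟ i)
    (edgeOf-unique ∘ Adj-end) (λ { ≡.refl → end-Adj uH vH (edgeOf-end a) })

  adj-inner-inner : ∀ i j w x → adj G (fromInner i w) (fromInner j x) ≈ I i j * adj H-uv w x
  adj-inner-inner i j w x = trans
    (ind-⇔ (adj? G (fromInner i w) (fromInner j x)) (i ≟ j ×-dec adj? H-uv w x) Adj-inner inner-Adj)
    (ind-× (i ≟ j) (adj? H-uv w x))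

  I-inner : ∀ i j w x → I (fromInner i w) (fromInner j x) ≈ I i j * I w x
  I-inner i j w x = trans
    (ind-⇔ (fromInner i w ≟ fromInner j x) (i ≟ j ×-dec w ≟ x) fromInner-injective
      (λ { (≡.refl , ≡.refl) → ≡.refl }))
    (ind-× (i ≟ j) (w ≟ x))

  ∑-order : ∀ (f : Vector Carrier order) →
            ∑ f ≈ ∑ (λ a → f (fromF a)) + ∑ (λ i → ∑ λ w → f (fromInner i w))
  ∑-order f = trans (∑-++ n (k ℕ.* p) f) (+-congˡ (∑-combine k p _))

  degree-F : ∀ a → ⟦ degree G (fromF a) ⟧ ≈ ⟦ n ⟧ - 1# + ⟦ p ⟧
  degree-F a = begin
    ⟦ degree G (fromF a) ⟧
      ≈⟨ trans (degree-∑ G (fromF a)) (∑-order _) ⟩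
    ∑ (λ b → adj G (fromF a) (fromF b)) + ∑ (λ i → ∑ λ w → adj G (fromF a) (fromInner i w))
      ≈⟨ +-cong (∑-cong (adj-F-F a)) (∑-cong λ i → trans (∑-cong (adj-F-inner a i)) (∑-constˡ p _)) ⟩
    ∑ (λ b → 1# - I a b) + ∑ (λ i → I (edgeOf a) i * ⟦ p ⟧)
      ≈⟨ +-cong (trans (∑-distrib-minus _ _) (+-cong (∑-1 n) (-‿cong (∑-I a)))) (∑-Iˡ (edgeOf a) λ _ → ⟦ p ⟧) ⟩
    ⟦ n ⟧ - 1# + ⟦ p ⟧  ∎

  degree-inner : ∀ i w → ⟦ degree G (fromInner i w) ⟧ ≈ ⟦ 2 ⟧ + ⟦ r ⟧
  degree-inner i w = begin
    ⟦ degree G (fromInner i w) ⟧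
      ≈⟨ trans (degree-∑ G (fromInner i w)) (∑-order _) ⟩
    ∑ (λ a → adj G (fromInner i w) (fromF a)) + ∑ (λ j → ∑ λ x → adj G (fromInner i w) (fromInner j x))
      ≈⟨ +-cong (∑-cong λ a → trans (adj-sym G (fromInner i w) (fromF a)) (adj-F-inner a i w))
                (∑-cong λ j → trans (∑-cong (adj-inner-inner i j w)) (sym (*-distribˡ-∑ (I i j) _))) ⟩
    ∑ (λ a → I (edgeOf a) i) + ∑ (λ j → I i j * ∑ (adj H-uv w))
      ≈⟨ +-cong (two-ends i) (∑-Iˡ i λ _ → ∑ (adj H-uv w)) ⟩
    ⟦ 2 ⟧ + ∑ (adj H-uv w)
      ≈⟨ +-congˡ (trans (sym (degree-∑ H-uv w)) (reflexive (≡.cong ⟦_⟧ (regular w)))) ⟩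
    ⟦ 2 ⟧ + ⟦ r ⟧  ∎

  module _ (x : Carrier) where
    -- As `A(K_n) = J - I` and the vertices of `F` have degree `n - 1 + p`, the part of `x I - Q(G)`
    -- on `F` is `δ I - J`. The Schur complement multiplies it by `y`, which turns `δ` into `s`.
    y δ s : Carrier
    y = y[ x ]
    δ = x - (⟦ p ⟧ + ⟦ n ⟧ - ⟦ 2 ⟧)
    s = y * δ

    N : Matrix order
    N a b = x * I a b - Q G a b

    B₀ : Matrix p
    B₀ = B[ x ]

    charPoly-N : charPoly (Q (complete n [ E , P ])) x ≡ Det N
    charPoly-N = charPoly≡Det (Q G) x

    -- Every row of the incidence matrix `W` has a single one, so `J` factors through the edges just
    -- as `W Wᵀ` does, and `y J + p W Wᵀ = W V`.
    V : Fin k → Fin n → Carrier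
    V i b = y + ⟦ p ⟧ * I i (edgeOf b)

    S : Matrix n
    S a b = s * I a b - ∑ λ i → I (edgeOf a) i * V i b

    N-off : ∀ {a b} → a ≢ b → N a b ≈ - adj G a b
    N-off {a} {b} a≢b = trans (+-cong (*-congˡ (I-off a≢b)) (-‿cong (+-congʳ (*-congˡ (I-off a≢b)))))
      (solve 3 (λ x d e → x :* con (+ 0) :- (d :* con (+ 0) :+ e) := :- e) refl x ⟦ degree G a ⟧ (adj G a b))

    N-inner : ∀ i j w w′ → N (fromInner i w) (fromInner j w′) ≈ I i j * B₀ w w′
    N-inner i j w w′ = trans
      (+-cong (*-congˡ (I-inner i j w w′))
        (-‿cong (+-cong (*-cong (degree-inner i w) (I-inner i j w w′)) (adj-inner-inner i j w w′))))
      (solve 5 (λ x d i w h → x :* (i :* w) :- (d :* (i :* w) :+ i :* h) := i :* ((x :- d) :* w :- h)) refl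
        x (⟦ 2 ⟧ + ⟦ r ⟧) (I i j) (I w w′) (adj H-uv w w′))

    N-F : ∀ a b → y * N (fromF a) (fromF b) - ∑ (λ j → adj G (fromF a) (n ↑ʳ j) * adj G (n ↑ʳ j) (fromF b)) ≈ S a b
    N-F a b = begin
      y * N (fromF a) (fromF b) - ∑ (λ j → adj G (fromF a) (n ↑ʳ j) * adj G (n ↑ʳ j) (fromF b))
        ≈⟨ +-cong (*-congˡ (+-cong (*-congˡ I-F) (-‿cong (+-cong (*-cong (degree-F a) I-F) (adj-F-F a b)))))
                  (-‿cong common) ⟩
      y * (x * I a b - ((⟦ n ⟧ - 1# + ⟦ p ⟧) * I a b + (1# - I a b))) - I (edgeOf a) (edgeOf b) * ⟦ p ⟧
        ≈⟨ solve 6 (λ y x i n p e → let one = con (+ 1) ; two = one :+ (one :+ con (+ 0)) in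
             y :* (x :* i :- ((n :- one :+ p) :* i :+ (one :- i))) :- e :* p :=
             y :* (x :- (p :+ n :- two)) :* i :- (y :+ p :* e)) refl
             y x (I a b) ⟦ n ⟧ ⟦ p ⟧ (I (edgeOf a) (edgeOf b)) ⟩
      s * I a b - V (edgeOf a) b
        ≈⟨ +-congˡ (-‿cong (∑-Iˡ (edgeOf a) (λ i → V i b))) ⟨
      S a b  ∎
      where
      I-F : I (fromF a) (fromF b) ≈ I a b
      I-F = I-injective fromF fromF-injective a b
      common : ∑ (λ j → adj G (fromF a) (n ↑ʳ j) * adj G (n ↑ʳ j) (fromF b)) ≈ I (edgeOf a) (edgeOf b) * ⟦ p ⟧
      common = begin
        ∑ (λ j → adj G (fromF a) (n ↑ʳ j) * adj G (n ↑ʳ j) (fromF b))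
          ≈⟨ ∑-combine k p _ ⟩
        ∑ (λ i → ∑ λ w → adj G (fromF a) (fromInner i w) * adj G (fromInner i w) (fromF b))
          ≈⟨ ∑-cong (λ i → trans (∑-cong λ w → *-cong (adj-F-inner a i w)
               (trans (adj-sym G (fromInner i w) (fromF b)) (adj-F-inner b i w))) (∑-constˡ p _)) ⟩
        ∑ (λ i → I (edgeOf a) i * I (edgeOf b) i * ⟦ p ⟧)
          ≈⟨ trans (∑-cong λ i → *-assoc _ _ _) (∑-Iˡ (edgeOf a) _) ⟩
        I (edgeOf b) (edgeOf a) * ⟦ p ⟧
          ≈⟨ *-congʳ (I-sym (edgeOf b) (edgeOf a)) ⟩
        I (edgeOf a) (edgeOf b) * ⟦ p ⟧  ∎

    eliminate-pockets : y ^ n * Det N ≈ Det S * Det B₀ ^ k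
    eliminate-pockets = begin
      y ^ n * Det N
        ≈⟨ schur n (k ℕ.* p) N y (λ _ _ → refl) (λ a j → N-off ↑ˡ≢↑ʳ) (λ j a → N-off (↑ˡ≢↑ʳ ∘ ≡.sym)) (λ _ _ → refl)
             (λ j b → combine-elim {P = λ j → ∑ (λ l → N (n ↑ʳ j) (n ↑ʳ l) * adj G (n ↑ʳ l) (fromF b)) ≈ y * adj G (n ↑ʳ j) (fromF b)}
               (λ i w → rows i w b) j) ⟩
      Det (λ a b → y * N (fromF a) (fromF b) - ∑ (λ j → adj G (fromF a) (n ↑ʳ j) * adj G (n ↑ʳ j) (fromF b)))
        * Det (λ i j → N (n ↑ʳ i) (n ↑ʳ j))
        ≈⟨ *-cong (Det-cong N-F) (Det-blockDiagonal k p B₀ _ N-inner) ⟩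
      Det S * Det B₀ ^ k  ∎
      where
      adj-inner-F : ∀ i w b → adj G (fromInner i w) (fromF b) ≈ I (edgeOf b) i
      adj-inner-F i w b = trans (adj-sym G (fromInner i w) (fromF b)) (adj-F-inner b i w)
      rows : ∀ i w b → ∑ (λ l → N (fromInner i w) (n ↑ʳ l) * adj G (n ↑ʳ l) (fromF b)) ≈ y * adj G (fromInner i w) (fromF b)
      rows i w b = begin
        ∑ (λ l → N (fromInner i w) (n ↑ʳ l) * adj G (n ↑ʳ l) (fromF b))
          ≈⟨ ∑-combine k p _ ⟩
        ∑ (λ j → ∑ λ w′ → N (fromInner i w) (fromInner j w′) * adj G (fromInner j w′) (fromF b))
          ≈⟨ ∑-cong (λ j → trans (∑-cong λ w′ → trans (*-cong (N-inner i j w w′) (adj-inner-F j w′ b))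
               (solve 3 (λ i h e → i :* h :* e := i :* e :* h) refl (I i j) (B₀ w w′) (I (edgeOf b) j)))
               (trans (sym (*-distribˡ-∑ _ _)) (*-congˡ (B₀-rowSum x w)))) ⟩
        ∑ (λ j → I i j * I (edgeOf b) j * y)
          ≈⟨ trans (∑-cong λ j → *-assoc _ _ _) (∑-Iˡ i _) ⟩
        I (edgeOf b) i * y
          ≈⟨ trans (*-comm _ _) (*-congˡ (sym (adj-inner-F i w b))) ⟩
        y * adj G (fromInner i w) (fromF b)  ∎

    b : Carrier
    b = s - ⟦ 2 ⟧ * ⟦ p ⟧

    -- The sum over `Fin 1` and the factor `1#` write `2 y J` as a column times a row, the form in
    -- which Sylvester's identity applies a second time.
    Dₖ : Matrix k
    Dₖ i j = b * I i j - ∑ λ (_ : Fin 1) → ⟦ 2 ⟧ * y * 1#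

    collapse-edges : s ^ k * Det S ≈ s ^ n * Det Dₖ
    collapse-edges = trans (sylvester n k s (λ a i → I (edgeOf a) i) V)
      (*-congˡ (Det-cong λ i j → begin
        s * I i j - ∑ (λ a → V i a * I (edgeOf a) j)
          ≈⟨ +-congˡ (-‿cong (trans (∑-cong (select i j)) (trans (sym (*-distribˡ-∑ _ _)) (*-congˡ (two-ends j))))) ⟩
        s * I i j - (y + ⟦ p ⟧ * I i j) * ⟦ 2 ⟧
          ≈⟨ solve 4 (λ s y p i → let one = con (+ 1) ; two = one :+ (one :+ con (+ 0)) in
               s :* i :- (y :+ p :* i) :* two := (s :- two :* p) :* i :- (two :* y :* one :+ con (+ 0))) refl
               s y ⟦ p ⟧ (I i j) ⟩
        b * I i j - (⟦ 2 ⟧ * y * 1# + 0#)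
          ≈⟨ +-congˡ (-‿cong (trans (∑-suc _) (+-congˡ (∑-zero _)))) ⟨
        Dₖ i j  ∎))
      where
      -- The factor `I (edgeOf a) j` allows `edgeOf a` to be replaced by `j` in `V i a`, after which
      -- only the number of ends of `j` remains to be summed.
      select : ∀ i j a → V i a * I (edgeOf a) j ≈ (y + ⟦ p ⟧ * I i j) * I (edgeOf a) j
      select i j a with edgeOf a ≟ j
      ... | yes ≡.refl = refl
      ... | no _       = trans (zeroʳ _) (sym (zeroʳ _))

    rank-one : b * Det Dₖ ≈ b ^ k * (b - ⟦ 2 ⟧ * y * ⟦ k ⟧)
    rank-one = begin
      b * Det Dₖ
        ≈⟨ *-congʳ (*-identityʳ b) ⟨
      b ^ 1 * Det Dₖ
        ≈⟨ sylvester k 1 b (λ _ _ → ⟦ 2 ⟧ * y) (λ _ _ → 1#) ⟩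
      b ^ k * Det {1} (λ i j → b * I i j - ∑ {k} (λ _ → 1# * (⟦ 2 ⟧ * y)))
        ≈⟨ *-congˡ (trans (Det-one _) (+-congˡ (-‿cong (∑-constˡ k _)))) ⟩
      b ^ k * (b * 1# - 1# * (⟦ 2 ⟧ * y) * ⟦ k ⟧)
        ≈⟨ *-congˡ (solve 3 (λ b t k → let one = con (+ 1) in
             b :* one :- one :* t :* k := b :- t :* k) refl b (⟦ 2 ⟧ * y) ⟦ k ⟧) ⟩
      b ^ k * (b - ⟦ 2 ⟧ * y * ⟦ k ⟧)  ∎

-- Division of the determinant of the pocket block by its row sum

module Deflation {c ℓ₁ ℓ₂} (K : RealClosedField c ℓ₁ ℓ₂) {p r : ℕ}
  (P : EdgePocket (suc p)) (regular : IsRegular r (EdgePocket.H-uv P)) where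

  open RealClosedField K
  open Spectra K
  open LinearAlgebra K
  open PocketBlock K P regular
  open import Relation.Binary.Reasoning.Setoid setoid

  -- As B₀ 1 = y 1, the Schur complement of B₀ gives y det(bordered) = - det B₀, which exhibits
  -- det B₀ / y as a polynomial.
  O : Matrix 1
  O _ _ = 0#

  -- The unit row at `zero` pairs to `1#` with the all-ones column, so the complement is `-1`; it
  -- requires a pocket with at least one inner vertex. The signs of `U` and `V` are those that
  -- `schur` expects of off-diagonal blocks.
  U : Fin 1 → Fin (suc p) → Carrier
  U _ j = - I zero j

  V : Fin (suc p) → Fin 1 → Carrier
  V _ _ = - 1#

  bordered : Carrier → Matrix (1 ℕ.+ suc p)
  bordered x = block O U V (B₀ x)

  g : Carrier → Carrier
  g x = - Det (bordered x)

  y*g≈Det : ∀ x → y x * g x ≈ Det (B₀ x)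
  y*g≈Det x = begin
    y x * - Det (bordered x)
      ≈⟨ solve 2 (λ y d → y :* (:- d) := :- ((y :* con (+ 1)) :* d)) refl (y x) (Det (bordered x)) ⟩
    - (y x ^ 1 * Det (bordered x))
      ≈⟨ -‿cong (schur 1 (suc p) (bordered x) (y x)
           (block-ˡˡ O U V (B₀ x)) (block-ˡʳ O U V (B₀ x)) (block-ʳˡ O U V (B₀ x)) (block-ʳʳ O U V (B₀ x))
           (λ i _ → trans (∑-cong λ j → *-identityʳ _) (trans (B₀-rowSum x i) (sym (*-identityʳ _))))) ⟩
    - (Det {1} (λ _ _ → y x * 0# - ∑ (λ j → I zero j * 1#)) * Det (B₀ x))
      ≈⟨ -‿cong (*-congʳ (trans (Det-one _) (+-congˡ (-‿cong (∑-Iˡ zero λ _ → 1#))))) ⟩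
    - ((y x * 0# - 1#) * Det (B₀ x))
      ≈⟨ solve 2 (λ y d → :- ((y :* con (+ 0) :- con (+ 1)) :* d) := d) refl (y x) (Det (B₀ x)) ⟩
    Det (B₀ x)  ∎

  poly-g : IsPoly g
  poly-g = poly-neg (poly-Det entry)
    where
    entry : ∀ a b → IsPoly (λ x → bordered x a b)
    entry a b with splitAt 1 a | splitAt 1 b
    ... | inj₁ _ | inj₁ _ = poly-const _
    ... | inj₁ _ | inj₂ _ = poly-const _
    ... | inj₂ _ | inj₁ _ = poly-const _
    ... | inj₂ _ | inj₂ _ = poly-minus (poly-* (poly-minus poly-id (poly-const _)) (poly-const _)) (poly-const _)

-- Characteristic polynomials of the pasted graph and of the pocket

module CharPoly {c ℓ₁ ℓ₂} (K : RealClosedField c ℓ₁ ℓ₂) {p r : ℕ} (P : EdgePocket (suc p))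
  (uH : ∀ w → Adj (EdgePocket.H P) (EdgePocket.u P) (EdgePocket.inner P w))
  (vH : ∀ w → Adj (EdgePocket.H P) (EdgePocket.v P) (EdgePocket.inner P w))
  (regular : IsRegular r (EdgePocket.H-uv P)) where

  open RealClosedField K
  open Spectra K
  open LinearAlgebra K
  open EdgePocket P
  open PocketBlock K P regular using (B₀) renaming (y to y[_])
  open Deflation K P regular public using (g; poly-g; y*g≈Det)
  open import Relation.Binary.Reasoning.Setoid setoid
  open import Algebra.Properties.Semiring.Mult semiring using (×1-homo-*)

  m : ℕ
  m = 2 ℕ.+ suc p

  α β : ℕ → Carrier → Carrier
  α k x = (x - ⟦ m ⟧ - ⟦ 4 ⟧ * ⟦ k ⟧ + ⟦ 4 ⟧) * (x - ⟦ 2 ⟧ * ⟦ r ⟧ - ⟦ 2 ⟧) - ⟦ 2 ⟧ * (⟦ m ⟧ - ⟦ 2 ⟧)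
  β k x = (x - ⟦ m ⟧ - ⟦ 2 ⟧ * ⟦ k ⟧ + ⟦ 4 ⟧) * (x - ⟦ 2 ⟧ * ⟦ r ⟧ - ⟦ 2 ⟧) - ⟦ 2 ⟧ * (⟦ m ⟧ - ⟦ 2 ⟧)

  ω : ℕ → Carrier
  ω k = ⟦ m ⟧ + ⟦ 2 ⟧ * ⟦ k ⟧ - ⟦ 4 ⟧

  m-2≈ : ⟦ m ⟧ - ⟦ 2 ⟧ ≈ ⟦ suc p ⟧
  m-2≈ = solve 1 (λ p → let one = con (+ 1) in
    (one :+ (one :+ p)) :- (one :+ (one :+ con (+ 0))) := p) refl ⟦ suc p ⟧

  y≈ : ∀ x → y[ x ] ≈ x - ⟦ 2 ⟧ * ⟦ r ⟧ - ⟦ 2 ⟧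
  y≈ x = solve 3 (λ x r t → x :- (r :+ t) := x :- r :- t) refl x (⟦ 2 ⟧ * ⟦ r ⟧) ⟦ 2 ⟧

  e-nonNeg : 0# ≤ ⟦ 2 ⟧ * (⟦ m ⟧ - ⟦ 2 ⟧)
  e-nonNeg = *-nonNeg (⟦⟧-nonNeg 2) (≤-respʳ-≈ (sym m-2≈) (⟦⟧-nonNeg (suc p)))

  α-splits : ∀ k → ∃₂ λ α₁ α₂ → RootsOf (α k) (α₁ ∷ α₂ ∷ [])
  α-splits k = let α₁ , α₂ , roots = quadratic-splits (⟦ m ⟧ + ⟦ 4 ⟧ * ⟦ k ⟧ - ⟦ 4 ⟧) (⟦ 2 ⟧ * ⟦ r ⟧ + ⟦ 2 ⟧) e-nonNeg in
    α₁ , α₂ , λ x → trans (+-congʳ (*-cong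
    (solve 4 (λ x m k f → x :- m :- k :+ f := x :- (m :+ k :- f)) refl x ⟦ m ⟧ (⟦ 4 ⟧ * ⟦ k ⟧) ⟦ 4 ⟧)
    (sym (y≈ x)))) (roots x)

  β-splits : ∀ k → ∃₂ λ β₁ β₂ → RootsOf (β k) (β₁ ∷ β₂ ∷ [])
  β-splits k = let β₁ , β₂ , roots = quadratic-splits (ω k) (⟦ 2 ⟧ * ⟦ r ⟧ + ⟦ 2 ⟧) e-nonNeg in
    β₁ , β₂ , λ x → trans (+-congʳ (*-cong
    (solve 4 (λ x m k f → x :- m :- k :+ f := x :- (m :+ k :- f)) refl x ⟦ m ⟧ (⟦ 2 ⟧ * ⟦ k ⟧) ⟦ 4 ⟧)
    (sym (y≈ x)))) (roots x)

  poly-α : ∀ k → IsPoly (α k)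
  poly-α k = let α₁ , α₂ , roots = α-splits k in RootsOf⇒IsPoly (α₁ ∷ α₂ ∷ []) roots

  poly-β : ∀ k → IsPoly (β k)
  poly-β k = let β₁ , β₂ , roots = β-splits k in RootsOf⇒IsPoly (β₁ ∷ β₂ ∷ []) roots

  module _ {k} (E : EdgeSet (complete (2 ℕ.* suc k)) (suc k)) (perfect : EdgeSet.IsPerfectMatching E) where
    open Pockets K {n = 2 ℕ.* suc k} {k = suc k} {p = suc p} {r = r} E perfect P uH vH regular using (N; charPoly-N; S; Dₖ; eliminate-pockets; collapse-edges; rank-one)
      renaming (δ to δ[_]; s to s[_]; b to b[_])

    n : ℕ
    n = 2 ℕ.* suc k

    factored : Carrier → Carrier
    factored x = (x - ω (suc k)) ^ suc k * β (suc k) x ^ k * α (suc k) x * g x ^ suc k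

    ⟦n⟧ : ⟦ n ⟧ ≈ ⟦ 2 ⟧ * ⟦ suc k ⟧
    ⟦n⟧ = ×1-homo-* 2 (suc k)

    δ≈ : ∀ x → δ[ x ] ≈ x - ω (suc k)
    δ≈ x = trans (+-congˡ (-‿cong (+-congʳ (+-congˡ ⟦n⟧))))
      (solve 3 (λ x p n → let one = con (+ 1) ; two = one :+ (one :+ con (+ 0)) in
        x :- (p :+ n :- two) := x :- (one :+ (one :+ p) :+ n :- (one :+ (one :+ two)))) refl
        x ⟦ suc p ⟧ (⟦ 2 ⟧ * ⟦ suc k ⟧))

    b≈β : ∀ x → b[ x ] ≈ β (suc k) x
    b≈β x = +-cong
      (trans (*-comm _ _) (*-cong
        (trans (δ≈ x) (solve 4 (λ x m n f → x :- (m :+ n :- f) := x :- m :- n :+ f) refl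
          x ⟦ m ⟧ (⟦ 2 ⟧ * ⟦ suc k ⟧) ⟦ 4 ⟧))
        (y≈ x)))
      (-‿cong (*-congˡ (sym m-2≈)))

    -- The rank-one correction is a multiple of `Y`, so it only shifts the other factor `X` by
    -- another `2 k`: the `2 k` in `β` becomes the `4 k` in `α`.
    b≈α : ∀ x → b[ x ] - ⟦ 2 ⟧ * y[ x ] * ⟦ suc k ⟧ ≈ α (suc k) x
    b≈α x = begin
      b[ x ] - ⟦ 2 ⟧ * y[ x ] * ⟦ suc k ⟧
        ≈⟨ +-cong (b≈β x) (-‿cong (*-congʳ (*-congˡ (y≈ x)))) ⟩
      X * Y - e - ⟦ 2 ⟧ * Y * ⟦ suc k ⟧
        ≈⟨ solve 5 (λ X Y e t n → X :* Y :- e :- t :* Y :* n := (X :- t :* n) :* Y :- e) refl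
             X Y e ⟦ 2 ⟧ ⟦ suc k ⟧ ⟩
      (X - ⟦ 2 ⟧ * ⟦ suc k ⟧) * Y - e
        ≈⟨ +-congʳ (*-congʳ (solve 3 (λ x m n → let one = con (+ 1) ; two = one :+ (one :+ con (+ 0)) in
             x :- m :- two :* n :+ (one :+ (one :+ two)) :- two :* n :=
             x :- m :- (one :+ (one :+ two)) :* n :+ (one :+ (one :+ two))) refl x ⟦ m ⟧ ⟦ suc k ⟧)) ⟩
      α (suc k) x  ∎
      where
      X = x - ⟦ m ⟧ - ⟦ 2 ⟧ * ⟦ suc k ⟧ + ⟦ 4 ⟧
      Y = x - ⟦ 2 ⟧ * ⟦ r ⟧ - ⟦ 2 ⟧
      e = ⟦ 2 ⟧ * (⟦ m ⟧ - ⟦ 2 ⟧)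

    ^n : ∀ x → x ^ n ≈ x ^ suc k * x ^ suc k
    ^n x = trans (^-homo-* x (suc k) (suc k ℕ.+ 0)) (*-congˡ (reflexive (≡.cong (x ^_) (ℕ.+-identityʳ (suc k)))))

    -- The three reductions carry the factors `y ^ n`, `s ^ suc k` and `b`. Their product is put in
    -- front at once, the reductions are applied under it, and it is cancelled as a whole; this is
    -- where `y`, `δ` and `b` must not vanish.
    Det-N-generic : ∀ x → y[ x ] ≉ 0# → δ[ x ] ≉ 0# → b[ x ] ≉ 0# →
                    Det (N x) ≈ δ[ x ] ^ suc k * b[ x ] ^ k * (b[ x ] - ⟦ 2 ⟧ * y[ x ] * ⟦ suc k ⟧) * g x ^ suc k
    Det-N-generic x y≉0 δ≉0 b≉0 = *-cancelˡ-≉0 scale≉0 (begin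
      b * s^ * (y^ * y^) * Det (N x)
        ≈⟨ trans (*-assoc _ _ _) (*-congˡ (trans (*-congʳ (sym (^n y))) (eliminate-pockets x))) ⟩
      b * s^ * (Det (S x) * Det (B₀ x) ^ suc k)
        ≈⟨ solve 4 (λ b s d e → b :* s :* (d :* e) := b :* (s :* d) :* e) refl b s^ (Det (S x)) _ ⟩
      b * (s^ * Det (S x)) * Det (B₀ x) ^ suc k
        ≈⟨ *-cong (*-congˡ (trans (collapse-edges x) (*-congʳ (^n s))))
                  (trans (^-congˡ (suc k) (sym (y*g≈Det x))) (^-distrib-* y (g x) (suc k))) ⟩
      b * (s^ * s^ * Det (Dₖ x)) * (y^ * g^)
        ≈⟨ solve 5 (λ b s d y g → b :* (s :* s :* d) :* (y :* g) := s :* s :* (b :* d) :* (y :* g)) refl b s^ (Det (Dₖ x)) y^ g^ ⟩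
      s^ * s^ * (b * Det (Dₖ x)) * (y^ * g^)
        ≈⟨ *-congʳ (*-cong (*-congˡ s^≈) (rank-one x)) ⟩
      s^ * (y^ * δ^) * (b * b ^ k * a) * (y^ * g^)
        ≈⟨ solve 7 (λ s y w b b′ a g → s :* (y :* w) :* (b :* b′ :* a) :* (y :* g) :=
             b :* s :* (y :* y) :* (w :* b′ :* a :* g)) refl s^ y^ δ^ b (b ^ k) a g^ ⟩
      b * s^ * (y^ * y^) * (δ^ * b ^ k * a * g^)  ∎)
      where
      y = y[ x ]
      s = s[ x ]
      b = b[ x ]
      a = b - ⟦ 2 ⟧ * y * ⟦ suc k ⟧
      y^ = y ^ suc k
      δ^ = δ[ x ] ^ suc k
      s^ = s ^ suc k
      g^ = g x ^ suc k
      s^≈ : s^ ≈ y^ * δ^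
      s^≈ = ^-distrib-* y δ[ x ] (suc k)
      scale≉0 : b * s^ * (y^ * y^) ≉ 0#
      scale≉0 = *-≉0 (*-≉0 b≉0 (^-≉0 (suc k) (*-≉0 y≉0 δ≉0))) (*-≉0 (^-≉0 (suc k) y≉0) (^-≉0 (suc k) y≉0))

    poly-Det-N : IsPoly (λ x → Det (N x))
    poly-Det-N = poly-Det λ a b → poly-minus (poly-* poly-id (poly-const _)) (poly-const _)

    Det-N : ∀ x → Det (N x) ≈ factored x
    Det-N = let β₁ , β₂ , roots = β-splits (suc k) in poly-ext poly-Det-N
      (poly-* (poly-* (poly-* (poly-^ (suc k) (poly-minus poly-id (poly-const _))) (poly-^ k (poly-β (suc k)))) (poly-α (suc k)))
              (poly-^ (suc k) poly-g))
      -- The zeros of `y`, of `δ` and, through `b≈β`, of `b`. The second is `ω (suc k)` in the form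
      -- in which `δ` subtracts it.
      ((⟦ 2 ⟧ * ⟦ r ⟧ + ⟦ 2 ⟧) ∷ (⟦ suc p ⟧ + ⟦ n ⟧ - ⟦ 2 ⟧) ∷ β₁ ∷ β₂ ∷ [])
      λ { x (x≉c ∷ x≉ω ∷ x≉β₁ ∷ x≉β₂ ∷ []) → trans
            (Det-N-generic x (x-y≉0 x≉c) (x-y≉0 x≉ω) (λ b≈0 →
              *-≉0 (x-y≉0 x≉β₁) (*-≉0 (x-y≉0 x≉β₂) 1≉0) (trans (sym (roots x)) (trans (sym (b≈β x)) b≈0))))
            (*-congʳ (*-cong (*-cong (^-congˡ (suc k) (δ≈ x)) (^-congˡ k (b≈β x))) (b≈α x))) }

    charPoly-G : ∀ x → charPoly (Q (complete (2 ℕ.* suc k) [ E , P ])) x ≈ factored x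
    charPoly-G x = trans (reflexive (charPoly-N x)) (Det-N x)

  open Single P
  open Pasting (complete 2) K₂-edge P using (G)

  charPoly-H : ∀ x → charPoly (Q H) x ≈ factored K₂-edge K₂-edge-perfect x
  charPoly-H x = begin
    charPoly (Q H) x
      ≡⟨ charPoly≡Det (Q H) x ⟩
    Det (λ a b → x * I a b - Q H a b)
      ≈⟨ Det-cong (λ a b → +-cong (*-congˡ (I-to a b)) (-‿cong (+-cong (*-cong (degree-to a) (I-to a b)) (adj-to a b)))) ⟨
    Det (λ a b → N₂ (toSingle a) (toSingle b))
      ≈⟨ Det-reindex toSingle fromSingle to∘from from∘to N₂ ⟩
    Det N₂
      ≈⟨ Det-N K₂-edge K₂-edge-perfect x ⟩
    factored K₂-edge K₂-edge-perfect x  ∎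
    where
    N₂ = Pockets.N K {n = 2 ℕ.* suc 0} {k = suc 0} {p = suc p} {r = r} K₂-edge K₂-edge-perfect P uH vH regular x
    I-to : ∀ a b → I (toSingle a) (toSingle b) ≈ I a b
    I-to = I-injective toSingle (λ {a} {b} eq →
      ≡.trans (≡.sym (from∘to a)) (≡.trans (≡.cong fromSingle eq) (from∘to b)))
    adj-to : ∀ a b → adj G (toSingle a) (toSingle b) ≈ adj H a b
    adj-to a b = ind-⇔ (adj? G (toSingle a) (toSingle b)) (adj? H a b) Adj-Single Single-Adj
    degree-to : ∀ a → ⟦ degree G (toSingle a) ⟧ ≈ ⟦ degree H a ⟧
    degree-to a = begin
      ⟦ degree G (toSingle a) ⟧                      ≈⟨ degree-∑ G (toSingle a) ⟩
      ∑ (adj G (toSingle a))                         ≈⟨ ∑-reindex toSingle fromSingle to∘from from∘to _ ⟩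
      ∑ (λ b → adj G (toSingle a) (toSingle b))      ≈⟨ ∑-cong (adj-to a) ⟩
      ∑ (adj H a)                                    ≈⟨ degree-∑ H a ⟨
      ⟦ degree H a ⟧                                 ∎

  -- At `k = 1` the exponent of `β` is `0`, `m + 2k - 4` is `m - 2`, and `m + 4k - 4` is `m`, so
  -- that `α 1` is the quadratic with roots `ζ` and `η`.
  charPoly-H-factored : ∀ ζ η →
    RootsOf (λ x → (x - ⟦ 2 ⟧ * ⟦ r ⟧ - ⟦ 2 ⟧) * (x - ⟦ m ⟧) - ⟦ 2 ⟧ * (⟦ m ⟧ - ⟦ 2 ⟧)) (ζ ∷ η ∷ []) →
    ∀ x → charPoly (Q H) x ≈ (x - (⟦ m ⟧ - ⟦ 2 ⟧)) * ((x - ζ) * ((x - η) * g x))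
  charPoly-H-factored ζ η roots x = begin
    charPoly (Q H) x
      ≈⟨ charPoly-H x ⟩
    (x - ω 1) ^ 1 * 1# * α 1 x * g x ^ 1
      ≈⟨ *-congʳ (*-cong
           (solve 2 (λ x m → let one = con (+ 1) ; two = one :+ (one :+ con (+ 0)) in
             (x :- (m :+ two :* (one :+ con (+ 0)) :- (one :+ (one :+ two)))) :* one :* one := x :- (m :- two)) refl x ⟦ m ⟧)
           (trans (+-congʳ (trans (*-congʳ
             (solve 3 (λ x m f → x :- m :- f :* (con (+ 1) :+ con (+ 0)) :+ f := x :- m) refl x ⟦ m ⟧ ⟦ 4 ⟧)) (*-comm _ _)))
             (roots x))) ⟩
    (x - (⟦ m ⟧ - ⟦ 2 ⟧)) * ((x - ζ) * ((x - η) * 1#)) * (g x * 1#)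
      ≈⟨ solve 4 (λ a z e g → a :* (z :* (e :* con (+ 1))) :* (g :* con (+ 1)) := a :* (z :* (e :* g))) refl
           (x - (⟦ m ⟧ - ⟦ 2 ⟧)) (x - ζ) (x - η) (g x) ⟩
    (x - (⟦ m ⟧ - ⟦ 2 ⟧)) * ((x - ζ) * ((x - η) * g x))  ∎

  -- The three linear factors are divided out in the order in which the multiset difference removes
  -- its entries; each intermediate quotient is again polynomial.
  RootsOf-g : ∀ ζ η →
    RootsOf (λ x → (x - ⟦ 2 ⟧ * ⟦ r ⟧ - ⟦ 2 ⟧) * (x - ⟦ m ⟧) - ⟦ 2 ⟧ * (⟦ m ⟧ - ⟦ 2 ⟧)) (ζ ∷ η ∷ []) →
    ∀ σH → IsSpectrum (Q H) σH → RootsOf g (σH ∖ (⟦ m ⟧ - ⟦ 2 ⟧ ∷ ζ ∷ η ∷ []))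
  RootsOf-g ζ η roots σH spectrum =
    RootsOf-remove poly-g η (remove ζ (remove (⟦ m ⟧ - ⟦ 2 ⟧) σH))
      (RootsOf-remove η-part ζ (remove (⟦ m ⟧ - ⟦ 2 ⟧) σH)
        (RootsOf-remove (poly-* (poly-minus poly-id (poly-const ζ)) η-part) (⟦ m ⟧ - ⟦ 2 ⟧) σH spectrum
          (charPoly-H-factored ζ η roots))
        (λ _ → refl))
      (λ _ → refl)
    where
    η-part : IsPoly (λ x → (x - η) * g x)
    η-part = poly-* (poly-minus poly-id (poly-const η)) poly-g

-- The spectrum of the signless Laplacian of the pasted graph

theorem4p5 : ∀ {c ℓ₁ ℓ₂} (K : RealClosedField c ℓ₁ ℓ₂) →
    let open RealClosedField K
        open Spectra K
    in
    (k p r₂ : ℕ) → let m = 2 ℕ.+ p in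
    1 ℕ.≤ k →
    3 ℕ.≤ m →
    2 ℕ.≤ r₂ →
    (E : EdgeSet (complete (2 ℕ.* k)) k) →
    EdgeSet.IsPerfectMatching E →
    (P : EdgePocket p) → let open EdgePocket P in
    degree H u ≡ m ∸ 1 →
    degree H v ≡ m ∸ 1 →
    IsRegular r₂ H-uv →
    (ζ η : Carrier) →
    RootsOf (λ x → (x - ⟦ 2 ⟧ * ⟦ r₂ ⟧ - ⟦ 2 ⟧) * (x - ⟦ m ⟧) - ⟦ 2 ⟧ * (⟦ m ⟧ - ⟦ 2 ⟧))
            (ζ ∷ η ∷ []) →
    (σH : List Carrier) →
    IsSpectrum (Q H) σH →
    ∃₂ λ α₁ α₂ → ∃₂ λ β₁ β₂ →
      RootsOf (λ x → (x - ⟦ m ⟧ - ⟦ 4 ⟧ * ⟦ k ⟧ + ⟦ 4 ⟧) * (x - ⟦ 2 ⟧ * ⟦ r₂ ⟧ - ⟦ 2 ⟧)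
                     - ⟦ 2 ⟧ * (⟦ m ⟧ - ⟦ 2 ⟧))
              (α₁ ∷ α₂ ∷ []) ×
      RootsOf (λ x → (x - ⟦ m ⟧ - ⟦ 2 ⟧ * ⟦ k ⟧ + ⟦ 4 ⟧) * (x - ⟦ 2 ⟧ * ⟦ r₂ ⟧ - ⟦ 2 ⟧)
                     - ⟦ 2 ⟧ * (⟦ m ⟧ - ⟦ 2 ⟧))
              (β₁ ∷ β₂ ∷ []) ×
      IsSpectrum (Q (complete (2 ℕ.* k) [ E , P ]))
        (concatMap (replicate k) (σH ∖ (⟦ m ⟧ - ⟦ 2 ⟧ ∷ ζ ∷ η ∷ []))
         ++ replicate k (⟦ m ⟧ + ⟦ 2 ⟧ * ⟦ k ⟧ - ⟦ 4 ⟧)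
         ++ (α₁ ∷ α₂ ∷ [])
         ++ replicate (k ∸ 1) β₁
         ++ replicate (k ∸ 1) β₂)
-- `p = 0` would mean `m = 2`, against `3 ≤ m`; in the other case a pocket has an inner vertex, as
-- the bordered determinant requires.
theorem4p5 K (suc k) zero    r₂ _ (s≤s (s≤s ())) _ E perfect P deg-u deg-v regular ζ η ζη σH spectrum
theorem4p5 K (suc k) (suc p) r₂ _ _ _ E perfect P deg-u deg-v regular ζ η ζη σH spectrum
  = answer (α-splits (suc k)) (β-splits (suc k))
  where
  open RealClosedField K
  open Spectra K
  open LinearAlgebra K
  open EdgePocket P
  open Pocket P
  open CharPoly K P (λ w → LinearAlgebra.full-degree K H deg-u (u≢inner w))
                    (λ w → LinearAlgebra.full-degree K H deg-v (v≢inner w)) regular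
  open import Relation.Binary.Reasoning.Setoid setoid

  rest : List Carrier
  rest = σH ∖ (⟦ m ⟧ - ⟦ 2 ⟧ ∷ ζ ∷ η ∷ [])

  answer : (∃₂ λ α₁ α₂ → RootsOf (α (suc k)) (α₁ ∷ α₂ ∷ [])) → (∃₂ λ β₁ β₂ → RootsOf (β (suc k)) (β₁ ∷ β₂ ∷ [])) → _
  answer (α₁ , α₂ , α-roots) (β₁ , β₂ , β-roots) = α₁ , α₂ , β₁ , β₂ , α-roots , β-roots , λ x → begin
    charPoly (Q (complete (2 ℕ.* suc k) [ E , P ])) x
      ≈⟨ charPoly-G E perfect x ⟩
    (x - ω (suc k)) ^ suc k * β (suc k) x ^ k * α (suc k) x * g x ^ suc k
      ≈⟨ *-cong (*-cong (*-congˡ (trans (^-congˡ k (β-roots x)) (β-powers x))) (α-roots x))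
                (^-congˡ (suc k) (RootsOf-g ζ η ζη σH spectrum x)) ⟩
    (x - ω (suc k)) ^ suc k * ((x - β₁) ^ k * (x - β₂) ^ k) * fromRoots (α₁ ∷ α₂ ∷ []) x * fromRoots rest x ^ suc k
      -- The factors are brought into the order of the list in the statement, since `fromRoots`
      -- turns concatenation into a product.
      ≈⟨ solve 4 (λ w b a g → w :* b :* a :* g := g :* (w :* (a :* b))) refl _ _ _ _ ⟩
    fromRoots rest x ^ suc k * ((x - ω (suc k)) ^ suc k * (fromRoots (α₁ ∷ α₂ ∷ []) x * ((x - β₁) ^ k * (x - β₂) ^ k)))
      ≈⟨ *-cong (fromRoots-concatMap (suc k) rest x) (*-cong (fromRoots-replicate (suc k) (ω (suc k)) x)
           (*-congˡ (*-cong (fromRoots-replicate k β₁ x) (fromRoots-replicate k β₂ x)))) ⟨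
    _
      ≈⟨ trans (fromRoots-++ (concatMap (replicate (suc k)) rest) (replicate (suc k) (ω (suc k)) ++ αs ++ βs) x)
          (*-congˡ (trans (fromRoots-++ (replicate (suc k) (ω (suc k))) (αs ++ βs) x)
          (*-congˡ (trans (fromRoots-++ αs βs x)
          (*-congˡ (fromRoots-++ (replicate k β₁) (replicate k β₂) x)))))) ⟨
    fromRoots (concatMap (replicate (suc k)) rest ++ replicate (suc k) (ω (suc k)) ++ αs ++ βs) x  ∎
    where
    αs βs : List Carrier
    αs = α₁ ∷ α₂ ∷ []
    βs = replicate k β₁ ++ replicate k β₂
    -- The determinant produces powers of the whole quadratic, while the list repeats each of its
    -- roots separately.
    β-powers : ∀ x → ((x - β₁) * ((x - β₂) * 1#)) ^ k ≈ (x - β₁) ^ k * (x - β₂) ^ k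
    β-powers x = trans (^-congˡ k (*-congˡ (*-identityʳ _))) (^-distrib-* (x - β₁) (x - β₂) k)
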